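{- Let $\boldsymbol\mu=(\mu_1,\dots,\mu_k)$ be a sequence of valuated matroids on $[n]$, of ranks $r_1\le\cdots\le r_k$, whose sequence of underlying matroids $\boldsymbol M=(M_1,\dots,M_k)$ is a flag matroid. Then the following are equivalent: (a) the image $(\overline{\mu_1},\dots,\overline{\mu_k})\in\prod_{i=1}^k\mathbb P(\mathbb T^{\binom{[n]}{r_i}})$ lies in the flag Dressian $FlDr(\boldsymbol M)$, i.e. it satisfies the tropical Grassmann–Plücker and tropical incidence–Plücker relations; (b) $\boldsymbol\mu$ is a valuated flag matroid (with underlying flag matroid $\boldsymbol M$); (c) the weight $w(B_1,\dots,B_k):=\sum_{i=1}^k\mu_i(B_i)$ on $\mathcal B(M_1)\times\cdots\times\mathcal B(M_k)$ induces a subdivision of the base configuration of $\boldsymbol M$ into base configurations of flag matroids; that is, for every $u\in\mathbb R^n$ the set of tuples $(B_1,\dots,B_k)\in\mathcal B(M_1)\times\cdots\times\mathcal B(M_k)$ minimizing $\sum_{i=1}^k\big(\mu_i(B_i)+\langle u,\mathbf e_{B_i}\rangle\big)$ equals $\mathcal B(N_1)\times\cdots\times\mathcal B(N_k)$ for some flag matroid $(N_1,\dots,N_k)$ on $[n]$; (d) the projective tropical linear spaces form a flag $\overline{\operatorname{trop}}(\mu_1)\subseteq\overline{\operatorname{trop}}(\mu_2)\subseteq\cdots\subseteq\overline{\operatorname{trop}}(\mu_k)$ in $\mathbb P(\mathbb T^{[n]})$.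
   Context: Tropical conventions: $\mathbb T=\mathbb R\cup\{\infty\}$ with $a\odot b=a+b$, $a\oplus b=\min(a,b)$. For a finite set $E$, $\mathbb P(\mathbb T^E)=(\mathbb T^E\setminus\{(\infty,\dots,\infty)\})/\sim$ where $u\sim u+c\mathbf 1$ for $c\in\mathbb R$; $\bar u$ denotes the class of $u$. For nonempty $S\subseteq E$, $T_S\subseteq\mathbb P(\mathbb T^E)$ is the set of classes of vectors whose finite coordinates are exactly those indexed by $S$; it is identified with $\mathbb R^S/\mathbb R\mathbf 1$. For a finite list of elements of $\mathbb T$, "the minimum is attained at least twice" is declared to hold also when all entries are $\infty$. $\mathbf e_B=\sum_{i\in B}\mathbf e_i$. Valuated matroids: a valuated matroid of rank $r$ on a finite set $E$ is a function $\mu:\binom{E}{r}\to\mathbb T$ such that $\mathcal B(M):=\{I:\mu(I)\neq\infty\}$ is the set of bases of a matroid $M$ on $E$ (the underlying matroid), and for all $B,B'\in\mathcal B(M)$ and $i\in B\setminus B'$ there is $j\in B'\setminus B$ with $\mu(B)+\mu(B')\ge\mu(B\setminus i\cup j)+\mu(B'\setminus j\cup i)$. For $S\subseteq E$, let $\mathcal B_S$ be the set of bases $B$ of $M$ with $|B\cap S|$ maximal; the contraction $\mu/_S$ is the function on $\binom{E\setminus S}{r-\operatorname{rk}_M(S)}$ (finite exactly on bases of $M/_S$), and the restriction $\mu|_S$ the function on $\binom{S}{\operatorname{rk}_M(S)}$ (finite exactly on bases of $M|_S$), determined up to additive constants by $\mu(B)=\mu|_S(B\cap S)+\mu/_S(B\setminus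 S)$ for all $B\in\mathcal B_S$; both are valuated matroids. The valuated circuits of $\mu$ are the vectors $\mathbf C_\mu(S)\in\mathbb T^E$, $S\in\binom{E}{r+1}$, with $C_\mu(S)_i=\mu(S\setminus i)$ if $i\in S$ and $\infty$ otherwise, excluding the all-$\infty$ vector. The tropical linear space $\operatorname{trop}(\mu)\subseteq\mathbb R^E/\mathbb R\mathbf 1$ is the set of $\bar u$ such that for every valuated circuit $\mathbf C$ the minimum of $\{C_i+u_i: C_i\neq\infty\}$ is attained at least twice. The projective tropical linear space of $\mu$ on $[n]$ is $\overline{\operatorname{trop}}(\mu)=\bigcup_{\emptyset\subseteq S\subsetneq[n]}\operatorname{trop}(\mu/_S)\times\{\infty\}^S\subseteq\mathbb P(\mathbb T^{[n]})$, with $\operatorname{trop}(\mu/_S)$ regarded as a subset of $T_{[n]\setminus S}$. Flag matroids: for matroids $M,N$ on $[n]$, $M\twoheadleftarrow N$ (matroid quotient) means every circuit of $N$ is a union of circuits of $M$; $(M_1,\dots,M_k)$ is a flag matroid if $M_i\twoheadleftarrow M_j$ for all $i<j$. Valuated flag matroids: for valuated matroids $\mu,\nu$ on $[n]$ of ranks $r\le s$ with underlying matroids $M,N$, $\mu\twoheadleftarrow\nu$ means: for all $I\in\mathcal B(M)$, $J\in\mathcal B(N)$, $i\in I\setminus J$ there is $j\in J\setminus I$ with $\mu(I)+\nu(J)\ge\mu(I\setminus i\cup j)+\nu(J\setminus j\cup i)$; $(\mu_1,\dots,\mu_k)$ is a valuated flag matroid if $\mu_i\twoheadleftarrow\mu_j$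 for all $i<j$. Flag Dressian: the tropical Grassmann–Plücker relations for $p\in\mathbb T^{\binom{[n]}{r}}$ require, for all $I,J\in\binom{[n]}{r}$ with $|I\cap J|<r-1$ and $i\in I\setminus J$, that the minimum of $\{p(I)+p(J)\}\cup\{p(I\setminus i\cup j)+p(J\setminus j\cup i): j\in J\setminus I\}$ is attained at least twice. The tropical incidence–Plücker relations for $(p,q)\in\mathbb T^{\binom{[n]}{r}}\times\mathbb T^{\binom{[n]}{s}}$, $r\le s$, require, for all $I'\in\binom{[n]}{r-1}$ and $J'\in\binom{[n]}{s+1}$, that the minimum of $\{p(I'\cup j)+q(J'\setminus j): j\in J'\setminus I'\}$ is attained at least twice. $FlDr(r_1,\dots,r_k;n)\subseteq\prod_i\mathbb P(\mathbb T^{\binom{[n]}{r_i}})$ is the set of $(\overline{p_1},\dots,\overline{p_k})$ with each $p_i$ satisfying the Grassmann–Plücker relations and each pair $(p_i,p_j)$, $i<j$, satisfying the incidence–Plücker relations. For a flag matroid $\boldsymbol M$ of rank $(r_1,\dots,r_k)$, $FlDr(\boldsymbol M)$ is the set of points of $FlDr(r_1,\dots,r_k;n)$ whose $i$-th component has finite coordinates exactly at $\mathcal B(M_i)$ for each $i$. -}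

module Defs where

open import Level using (0ℓ)
open import Data.Nat.Base as ℕ using (ℕ; zero; suc)
open import Data.Fin.Base as Fin using (Fin)
open import Data.Fin.Subset using (Subset; _∈_; _∉_; _⊆_; _⊂_; _∪_; _∩_; _─_; _-_; ⁅_⁆; ∣_∣; ∁)
open import Data.Vec.Base using (lookup; tabulate)
open import Data.Bool.Base using (Bool; true; false; if_then_else_)
open import Data.Product using (Σ; ∃; ∃-syntax; _×_; _,_)
open import Data.Sum.Base using (_⊎_)
open import Data.Maybe.Base using (Maybe; just; nothing)
open import Relation.Nullary using (¬_)
open import Relation.Binary.PropositionalEquality using (_≡_)
open import Relation.Binary.Structures using (IsTotalOrder)
open import Algebra.Structures using (IsCommutativeRing)
open import Function.Bundles using (_⇔_)

-- The real numbers, axiomatised as a Dedekind-complete totally ordered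
-- field (this characterises ℝ up to isomorphism).  The equality is a
-- setoid equality _≈_.

record Reals : Set₁ where
  infix  4 _≈_ _≤_
  infixl 6 _+_
  infixl 7 _*_
  field
    Carrier : Set
    _≈_ : Carrier → Carrier → Set
    _+_ _*_ : Carrier → Carrier → Carrier
    -_ : Carrier → Carrier
    0# 1# : Carrier
    _≤_ : Carrier → Carrier → Set
    isCommutativeRing : IsCommutativeRing _≈_ _+_ _*_ -_ 0# 1#
    0≉1 : ¬ (0# ≈ 1#)
    inverse : ∀ x → ¬ (x ≈ 0#) → ∃[ y ] (x * y ≈ 1#)
    isTotalOrder : IsTotalOrder _≈_ _≤_
    +-mono-≤ : ∀ {x y} z → x ≤ y → x + z ≤ y + z
    *-nonneg : ∀ {x y} → 0# ≤ x → 0# ≤ y → 0# ≤ x * y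
    sup : (P : Carrier → Set) → (∃[ x ] P x) → (∃[ b ] (∀ x → P x → x ≤ b)) →
          ∃[ s ] ((∀ x → P x → x ≤ s) × (∀ b → (∀ x → P x → x ≤ b) → s ≤ b))

module Trop (ℝ : Reals) where
  open Reals ℝ renaming (Carrier to R)

  data 𝕋 : Set where
    fin : R → 𝕋
    ∞   : 𝕋

  infixl 6 _⊙_
  infix  4 _≤T_ _≈T_

  _⊙_ : 𝕋 → 𝕋 → 𝕋
  fin a ⊙ fin b = fin (a + b)
  _     ⊙ _     = ∞

  data _≤T_ : 𝕋 → 𝕋 → Set where
    fin≤fin : ∀ {a b} → a ≤ b → fin a ≤T fin b
    _≤∞     : ∀ x → x ≤T ∞

  data _≈T_ : 𝕋 → 𝕋 → Set where
    fin≈fin : ∀ {a b} → a ≈ b → fin a ≈T fin b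
    ∞≈∞     : ∞ ≈T ∞

  Finite : 𝕋 → Set
  Finite x = ¬ (x ≡ ∞)

  isInf : 𝕋 → Bool
  isInf (fin _) = false
  isInf ∞       = true

  -- "the minimum of the family v over the index set P is attained at
  -- least twice"; declared to hold also when all entries are ∞.
  MinTwice : {A : Set} → (A → Set) → (A → 𝕋) → Set
  MinTwice {A} P v =
    (∀ a → P a → v a ≡ ∞) ⊎
    (∃[ a ] ∃[ b ] (P a × P b × ¬ (a ≡ b) ×
       (∀ c → P c → (v a ≤T v c) × (v b ≤T v c))))

  sumR : ∀ {m} → (Fin m → R) → R
  sumR {zero}  f = 0#
  sumR {suc m} f = f Fin.zero + sumR (λ i → f (Fin.suc i))

  sumT : ∀ {m} → (Fin m → 𝕋) → 𝕋
  sumT {zero}  f = fin 0#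
  sumT {suc m} f = f Fin.zero ⊙ sumT (λ i → f (Fin.suc i))

  ⟨_,e_⟩ : ∀ {n} → (Fin n → R) → Subset n → R
  ⟨ u ,e B ⟩ = sumR (λ i → if lookup B i then u i else 0#)

  swap : ∀ {n} → Subset n → Fin n → Fin n → Subset n
  swap B i j = (B - i) ∪ ⁅ j ⁆

  module _ {n : ℕ} where

    IsMatroid : (Subset n → Set) → Set
    IsMatroid 𝓑 =
      (∃[ B ] 𝓑 B) ×
      (∀ B B' → 𝓑 B → 𝓑 B' → ∀ i → i ∈ B → i ∉ B' →
         ∃[ j ] (j ∈ B' × j ∉ B × 𝓑 (swap B i j)))

    Independent : (Subset n → Set) → Subset n → Set
    Independent 𝓑 X = ∃[ B ] (𝓑 B × X ⊆ B)

    Circuit : (Subset n → Set) → Subset n → Set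
    Circuit 𝓑 C = ¬ Independent 𝓑 C × (∀ X → X ⊂ C → Independent 𝓑 X)

    -- matroid quotient M ↞ N : every circuit of N is a union of circuits of M
    MatroidQuotient : (Subset n → Set) → (Subset n → Set) → Set
    MatroidQuotient 𝓑M 𝓑N =
      ∀ C → Circuit 𝓑N C → ∀ e → e ∈ C →
        ∃[ D ] (Circuit 𝓑M D × D ⊆ C × e ∈ D)

    IsFlagMatroid : ∀ {k} → (Fin k → Subset n → Set) → Set
    IsFlagMatroid {k} 𝓑 =
      (∀ i → IsMatroid (𝓑 i)) × (∀ (i j : Fin k) → i Fin.< j → MatroidQuotient (𝓑 i) (𝓑 j))

    -- Valuated matroids.  A valuated matroid of rank r is represented by
    -- μ : Subset n → 𝕋, of which only the values on r-element subsets
    -- are relevant (they are the only ones ever inspected).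

    Bases : (Subset n → 𝕋) → ℕ → Subset n → Set
    Bases μ r I = ∣ I ∣ ≡ r × Finite (μ I)

    IsValuatedMatroid : (Subset n → 𝕋) → ℕ → Set
    IsValuatedMatroid μ r =
      IsMatroid (Bases μ r) ×
      (∀ B B' → Bases μ r B → Bases μ r B' → ∀ i → i ∈ B → i ∉ B' →
         ∃[ j ] (j ∈ B' × j ∉ B ×
           (μ (swap B i j) ⊙ μ (swap B' j i) ≤T μ B ⊙ μ B')))

    ValuatedQuotient : (Subset n → 𝕋) → ℕ → (Subset n → 𝕋) → ℕ → Set
    ValuatedQuotient μ r ν s =
      ∀ I J → Bases μ r I → Bases ν s J → ∀ i → i ∈ I → i ∉ J →
        ∃[ j ] (j ∈ J × j ∉ I ×
          (μ (swap I i j) ⊙ ν (swap J j i) ≤T μ I ⊙ ν J))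

    GrassmannPlucker : (Subset n → 𝕋) → ℕ → Set
    GrassmannPlucker p r =
      ∀ I J → ∣ I ∣ ≡ r → ∣ J ∣ ≡ r → suc (∣ I ∩ J ∣) ℕ.< r →
      ∀ i → i ∈ I → i ∉ J →
        MinTwice {Maybe (Fin n)}
          (λ { nothing → Data.Unit.⊤ ; (just j) → j ∈ J × j ∉ I })
          (λ { nothing → p I ⊙ p J ; (just j) → p (swap I i j) ⊙ p (swap J j i) })
      where import Data.Unit

    IncidencePlucker : (Subset n → 𝕋) → ℕ → (Subset n → 𝕋) → ℕ → Set
    IncidencePlucker p r q s =
      ∀ I' J' → suc ∣ I' ∣ ≡ r → ∣ J' ∣ ≡ suc s →
        MinTwice {Fin n} (λ j → j ∈ J' × j ∉ I')
                 (λ j → p (I' ∪ ⁅ j ⁆) ⊙ q (J' - j))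

    BasesMaxMeet : (Subset n → 𝕋) → ℕ → Subset n → Subset n → Set
    BasesMaxMeet μ r S B =
      Bases μ r B × (∀ B' → Bases μ r B' → ∣ B' ∩ S ∣ ℕ.≤ ∣ B ∩ S ∣)

    -- ν (of rank r') is a contraction μ/_S, i.e. ν is finite exactly on
    -- the bases of M/_S (the sets B ∖ S, B ∈ 𝓑_S) and for some ρ = μ|_S
    -- one has μ(B) = μ|_S(B ∩ S) + μ/_S(B ∖ S) for all B ∈ 𝓑_S.
    IsContraction : (Subset n → 𝕋) → ℕ → Subset n → (Subset n → 𝕋) → ℕ → Set
    IsContraction μ r S ν r' =
      (∀ B → BasesMaxMeet μ r S B → ∣ B ─ S ∣ ≡ r') ×
      (∀ J → J ⊆ ∁ S → ∣ J ∣ ≡ r' → Finite (ν J) →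
         ∃[ B ] (BasesMaxMeet μ r S B × (B ─ S) ≡ J)) ×
      (Σ (Subset n → 𝕋) λ ρ → (∀ B → BasesMaxMeet μ r S B →
                  μ B ≈T ρ (B ∩ S) ⊙ ν (B ─ S)))

    -- x restricted to the ground set E (x finite on E) lies in trop(ν),
    -- ν a valuated matroid of rank r' on E : for every valuated circuit
    -- C_ν(S'), S' ⊆ E, |S'| = r'+1, the minimum of C_i + x_i over the
    -- i with C_i ≠ ∞ is attained at least twice.
    InTrop : (Subset n → 𝕋) → ℕ → Subset n → (Fin n → 𝕋) → Set
    InTrop ν r' E x =
      ∀ S' → S' ⊆ E → ∣ S' ∣ ≡ suc r' →
        MinTwice {Fin n} (λ i → i ∈ S' × Finite (ν (S' - i)))
                 (λ i → ν (S' - i) ⊙ x i)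

    -- a representative x of a point of ℙ(𝕋^[n]) (some coordinate finite)
    IsProjPoint : (Fin n → 𝕋) → Set
    IsProjPoint x = ∃[ i ] Finite (x i)

    infSet : (Fin n → 𝕋) → Subset n
    infSet x = tabulate (λ i → isInf (x i))

    InProjTrop : (Subset n → 𝕋) → ℕ → (Fin n → 𝕋) → Set
    InProjTrop μ r x =
      IsProjPoint x ×
      ∃[ ν ] ∃[ r' ] (IsContraction μ r (infSet x) ν r' ×
                      InTrop ν r' (∁ (infSet x)) x)

    module _ {k : ℕ} (r : Fin k → ℕ) (μ : Fin k → Subset n → 𝕋) where

      CondA : Set
      CondA = (∀ i → GrassmannPlucker (μ i) (r i)) ×
              (∀ i j → i Fin.< j → IncidencePlucker (μ i) (r i) (μ j) (r j))

      CondB : Set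
      CondB = ∀ i j → i Fin.< j → ValuatedQuotient (μ i) (r i) (μ j) (r j)

      weight : (Fin n → R) → (Fin k → Subset n) → 𝕋
      weight u B = sumT (λ i → μ i (B i) ⊙ fin ⟨ u ,e B i ⟩)

      IsMinimizer : (Fin n → R) → (Fin k → Subset n) → Set
      IsMinimizer u B =
        (∀ i → Bases (μ i) (r i) (B i)) ×
        (∀ B' → (∀ i → Bases (μ i) (r i) (B' i)) → weight u B ≤T weight u B')

      CondC : Set₁
      CondC = ∀ (u : Fin n → R) →
        ∃[ 𝓝 ] (IsFlagMatroid {k} 𝓝 ×
                (∀ B → IsMinimizer u B ⇔ (∀ i → 𝓝 i (B i))))

      CondD : Set
      CondD = ∀ i j → i Fin.< j → ∀ x → InProjTrop (μ i) (r i) x → InProjTrop (μ j) (r j) x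

{-# OPTIONS --safe #-}
module Submission where

-- Everything is compared with the exchange condition (b).
--
-- (a) ⇔ (b): the incidence relation of I - i and J + i says precisely that the
-- term of index i is not the unique minimum, which is the exchange for (I, J, i).
--
-- (b) ⇒ (c): exchange is invariant under tilting by u and hence passes to
-- minimisers; simultaneous exchange of bases implies the matroid quotient.
-- (c) ⇒ (b): if exchange fails at (I, J, e), a weight u can be chosen coordinate
-- by coordinate such that e lies in a minimiser for μ but in none for ν, so that
-- {e} is a circuit of the second initial matroid but not a union of circuits of
-- the first.
--
-- (b) ⇔ (d): the projective tropical linear space consists of the points
-- orthogonal to all valuated circuits.  A point of the space of μ has optimal
-- bases through each finite coordinate, and exchanging them with bases of ν gives
-- orthogonality to the circuits of ν.  Conversely, orthogonality of the valuated
-- cocircuits of μ to the circuits of ν is the incidence relation.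
--
-- The order of the axiomatised reals is decidable: suprema of arbitrary
-- predicates give the weak excluded middle and the stability of ≤.

open import Defs
open import Data.Nat.Base as ℕ using (ℕ; zero; suc; _≤_)
import Data.Nat.Properties as ℕₚ
open import Data.Bool.Base using (true; false)
open import Data.Fin.Base as Fin using (Fin; zero; suc) renaming (_≤_ to _≤ᶠ_)
open import Data.Fin.Properties using (_≟_; any?)
open import Data.Fin.Subset using (Subset; _∈_; _∉_; _⊆_; _⊂_; _∪_; _∩_; _─_; _-_; ⁅_⁆; ∣_∣; ∁)
open import Data.Fin.Subset.Properties
open import Data.Vec.Base using ([]; _∷_; here; there)
open import Data.Vec.Functional using (updateAt)
open import Data.Vec.Functional.Properties using (updateAt-updates; updateAt-minimal)
open import Data.Vec.Properties using (lookup⇒[]=; []=⇒lookup; lookup∘tabulate)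
open import Data.List.Base as List using (List; []; _∷_)
open import Data.List.Membership.Propositional using () renaming (_∈_ to _∈ₗ_)
open import Data.List.Membership.Propositional.Properties using (∈-map⁺; ∈-++⁺ˡ; ∈-++⁺ʳ; ∈-allFin)
open import Data.List.Relation.Unary.Any using (here; there)
open import Data.Maybe.Base using (just; nothing)
open import Data.Product using (∃; ∃-syntax; _×_; _,_; proj₁; proj₂)
open import Data.Sum.Base using (_⊎_; inj₁; inj₂; [_,_]′)
open import Data.Empty using (⊥-elim)
open import Data.Unit.Base using (tt)
open import Function.Base using (_∘_; id)
open import Function.Bundles using (_⇔_; mk⇔; Equivalence)
open import Relation.Nullary using (¬_; Dec; yes; no; ¬?; _×-dec_; contradiction)
open import Relation.Nullary.Decidable using (map′; decidable-stable)
open import Algebra.Bundles using (CommutativeMonoid; Ring)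
open import Algebra.Structures using (IsCommutativeRing)
open import Relation.Binary.Structures using (IsTotalOrder)
open import Relation.Unary using (Decidable)
open import Relation.Binary.Definitions using (Total; Transitive; DecidableEquality)
open import Relation.Binary.PropositionalEquality using (_≡_; _≢_; refl; sym; trans; cong; cong₂; subst; subst₂)

-- Finite extremisation

module _ {A V : Set} {_≼_ : V → V → Set} (total : Total _≼_) (≼-trans : Transitive _≼_)
         (f : A → V) {P : A → Set} (P? : Decidable P) where

  argmin-list : (l : List A) →
    (∀ a → a ∈ₗ l → ¬ P a) ⊎ (∃[ m ] (P m × (∀ a → a ∈ₗ l → P a → f m ≼ f a)))
  argmin-list [] = inj₁ λ _ ()
  argmin-list (a ∷ l) with P? a | argmin-list l
  ... | no ¬pa | inj₁ none = inj₁ λ where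
    _ (here refl) → ¬pa
    b (there b∈l) → none b b∈l
  ... | no ¬pa | inj₂ (m , pm , min) = inj₂ (m , pm , λ where
    _ (here refl) pa → contradiction pa ¬pa
    b (there b∈l) → min b b∈l)
  ... | yes pa | inj₁ none = inj₂ (a , pa , λ where
    _ (here refl) _ → [ id , id ]′ (total (f a) (f a))
    b (there b∈l) pb → contradiction pb (none b b∈l))
  ... | yes pa | inj₂ (m , pm , min) with total (f a) (f m)
  ...   | inj₁ a≼m = inj₂ (a , pa , λ where
    _ (here refl) _ → [ id , id ]′ (total (f a) (f a))
    b (there b∈l) pb → ≼-trans a≼m (min b b∈l pb))
  ...   | inj₂ m≼a = inj₂ (m , pm , λ where
    _ (here refl) _ → m≼a
    b (there b∈l) → min b b∈l)

subsets : ∀ n → List (Subset n)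
subsets zero = [] ∷ []
subsets (suc n) = List.map (true ∷_) (subsets n) List.++ List.map (false ∷_) (subsets n)

∈-subsets : ∀ {n} (B : Subset n) → B ∈ₗ subsets n
∈-subsets [] = here refl
∈-subsets (true ∷ B) = ∈-++⁺ˡ (∈-map⁺ (true ∷_) (∈-subsets B))
∈-subsets (false ∷ B) = ∈-++⁺ʳ _ (∈-map⁺ (false ∷_) (∈-subsets B))

module _ {n} {V : Set} {_≼_ : V → V → Set} (total : Total _≼_) (≼-trans : Transitive _≼_)
         (f : Subset n → V) {P : Subset n → Set} (P? : Decidable P) where

  -- The order on values is a parameter, so that `ℕ._≥_` turns minimisers into maximisers.
  argmin : ∃ P → ∃[ m ] (P m × (∀ a → P a → f m ≼ f a))
  argmin (b , pb) with argmin-list total ≼-trans f P? (subsets n)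
  ... | inj₁ none = contradiction pb (none b (∈-subsets b))
  ... | inj₂ (m , pm , min) = m , pm , λ a → min a (∈-subsets a)

allSubset? : ∀ {n} {P : Subset n → Set} → Decidable P → Dec (∀ B → P B)
allSubset? P? with anySubset? (¬? ∘ P?)
... | yes (B , ¬pB) = no λ all → ¬pB (all B)
... | no none = yes λ B → decidable-stable (P? B) λ ¬pB → none (B , ¬pB)

implies? : ∀ {A B : Set} → Dec A → Dec B → Dec (A → B)
implies? (yes a) (yes b) = yes λ _ → b
implies? (yes a) (no ¬b) = no λ f → ¬b (f a)
implies? (no ¬a) _ = yes λ a → contradiction a ¬a

updateAt-all : ∀ {k} {A : Set} {P : Fin k → A → Set} {f : Fin k → A} {c a} →
  (∀ i → P i (f i)) → P c a → ∀ i → P i (updateAt f c (λ _ → a) i)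
updateAt-all {P = P} {f} {c} Pf Pa i with i ≟ c
... | yes refl = subst (P c) (sym (updateAt-updates c f)) Pa
... | no i≢c = subst (P i) (sym (updateAt-minimal i c f i≢c)) (Pf i)

-- Subsets

module _ {n : ℕ} where

  ∈─⇒∉ : ∀ {m x} (p q : Subset m) → x ∈ p ─ q → x ∉ q
  ∈─⇒∉ (_ ∷ p) (false ∷ q) (there x∈) (there x∈q) = ∈─⇒∉ p q x∈ x∈q
  ∈─⇒∉ (_ ∷ p) (true ∷ q) (there x∈) (there x∈q) = ∈─⇒∉ p q x∈ x∈q

  ∈-─⁻ : ∀ {x} (p q : Subset n) → x ∈ p ─ q → x ∈ p × x ∉ q
  ∈-─⁻ p q x∈ = p─q⊆p p q x∈ , ∈─⇒∉ p q x∈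

  ∈--⁻ : ∀ {x y} (p : Subset n) → x ∈ p - y → x ∈ p × x ≢ y
  ∈--⁻ {y = y} p x∈ = p─q⊆p p ⁅ y ⁆ x∈ , x∉⁅y⁆⇒x≢y (∈─⇒∉ p ⁅ y ⁆ x∈)

  ∉- : ∀ {x} (p : Subset n) → x ∉ p - x
  ∉- p x∈ = proj₂ (∈--⁻ p x∈) refl

  ∈-∪⁅⁆ʳ : ∀ (p : Subset n) x → x ∈ p ∪ ⁅ x ⁆
  ∈-∪⁅⁆ʳ p x = q⊆p∪q p ⁅ x ⁆ (x∈⁅x⁆ x)

  ∈-∪⁅⁆ˡ : ∀ {p : Subset n} {x} y → x ∈ p → x ∈ p ∪ ⁅ y ⁆
  ∈-∪⁅⁆ˡ y = p⊆p∪q ⁅ y ⁆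

  ∈-∪⁅⁆⁻ : ∀ {x y} (p : Subset n) → x ∈ p ∪ ⁅ y ⁆ → x ∈ p ⊎ x ≡ y
  ∈-∪⁅⁆⁻ {y = y} p x∈ with x∈p∪q⁻ p ⁅ y ⁆ x∈
  ... | inj₁ x∈p = inj₁ x∈p
  ... | inj₂ x∈y = inj₂ (x∈⁅y⁆⇒x≡y y x∈y)

  ∈∧∉⇒≢ : ∀ {p : Subset n} {x y} → x ∈ p → y ∉ p → x ≢ y
  ∈∧∉⇒≢ x∈p y∉p refl = y∉p x∈p

  insert-delete : ∀ {p : Subset n} {x} → x ∈ p → (p - x) ∪ ⁅ x ⁆ ≡ p
  insert-delete {p} {x} x∈p = ⊆-antisym
    (λ k∈ → [ (λ k∈p-x → proj₁ (∈--⁻ p k∈p-x)) , (λ { refl → x∈p }) ]′ (∈-∪⁅⁆⁻ (p - x) k∈))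
    to
    where
    to : p ⊆ (p - x) ∪ ⁅ x ⁆
    to {k} k∈p with k ≟ x
    ... | yes refl = ∈-∪⁅⁆ʳ (p - x) x
    ... | no k≢x = ∈-∪⁅⁆ˡ x (x∈p∧x≢y⇒x∈p-y k∈p k≢x)

  delete-insert : ∀ {p : Subset n} {x} → x ∉ p → (p ∪ ⁅ x ⁆) - x ≡ p
  delete-insert {p} {x} x∉p = ⊆-antisym from
    (λ k∈p → x∈p∧x≢y⇒x∈p-y (∈-∪⁅⁆ˡ x k∈p) (∈∧∉⇒≢ k∈p x∉p))
    where
    from : (p ∪ ⁅ x ⁆) - x ⊆ p
    from k∈ with ∈--⁻ (p ∪ ⁅ x ⁆) k∈
    ... | k∈p∪x , k≢x = [ id , (λ k≡x → contradiction k≡x k≢x) ]′ (∈-∪⁅⁆⁻ p k∈p∪x)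

  delete-insert-comm : ∀ (p : Subset n) {x y} → x ≢ y → (p - x) ∪ ⁅ y ⁆ ≡ (p ∪ ⁅ y ⁆) - x
  delete-insert-comm p {x} {y} x≢y = ⊆-antisym to from
    where
    to : (p - x) ∪ ⁅ y ⁆ ⊆ (p ∪ ⁅ y ⁆) - x
    to k∈ with ∈-∪⁅⁆⁻ (p - x) k∈
    ... | inj₁ k∈p-x = x∈p∧x≢y⇒x∈p-y (∈-∪⁅⁆ˡ y (proj₁ (∈--⁻ p k∈p-x))) (proj₂ (∈--⁻ p k∈p-x))
    ... | inj₂ refl = x∈p∧x≢y⇒x∈p-y (∈-∪⁅⁆ʳ p y) (x≢y ∘ sym)
    from : (p ∪ ⁅ y ⁆) - x ⊆ (p - x) ∪ ⁅ y ⁆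
    from k∈ with ∈--⁻ (p ∪ ⁅ y ⁆) k∈
    ... | k∈p∪y , k≢x with ∈-∪⁅⁆⁻ p k∈p∪y
    ...   | inj₁ k∈p = ∈-∪⁅⁆ˡ y (x∈p∧x≢y⇒x∈p-y k∈p k≢x)
    ...   | inj₂ refl = ∈-∪⁅⁆ʳ (p - x) y

∣insert∣ : ∀ {n} (p : Subset n) x → x ∉ p → ∣ p ∪ ⁅ x ⁆ ∣ ≡ suc ∣ p ∣
∣insert∣ (true ∷ p) zero x∉p = contradiction here x∉p
∣insert∣ (false ∷ p) zero x∉p = cong (suc ∘ ∣_∣) (∪-identityʳ p)
∣insert∣ (true ∷ p) (suc x) x∉p = cong suc (∣insert∣ p x (x∉p ∘ there))
∣insert∣ (false ∷ p) (suc x) x∉p = ∣insert∣ p x (x∉p ∘ there)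

∣delete∣ : ∀ {n} {p : Subset n} {x} → x ∈ p → suc ∣ p - x ∣ ≡ ∣ p ∣
∣delete∣ {p = p} {x} x∈p =
  trans (sym (∣insert∣ (p - x) x (∉- p))) (cong ∣_∣ (insert-delete x∈p))

∣∩∣+∣─∣ : ∀ {n} (p q : Subset n) → ∣ p ∩ q ∣ ℕ.+ ∣ p ─ q ∣ ≡ ∣ p ∣
∣∩∣+∣─∣ [] [] = refl
∣∩∣+∣─∣ (true ∷ p) (true ∷ q) = cong suc (∣∩∣+∣─∣ p q)
∣∩∣+∣─∣ (true ∷ p) (false ∷ q) = trans (ℕₚ.+-suc _ _) (cong suc (∣∩∣+∣─∣ p q))
∣∩∣+∣─∣ (false ∷ p) (true ∷ q) = ∣∩∣+∣─∣ p q
∣∩∣+∣─∣ (false ∷ p) (false ∷ q) = ∣∩∣+∣─∣ p q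

⊆∧∣∣≥⇒≡ : ∀ {n} {p q : Subset n} → p ⊆ q → ∣ q ∣ ℕ.≤ ∣ p ∣ → p ≡ q
⊆∧∣∣≥⇒≡ {p = p} {q} p⊆q q≤p = ⊆-antisym p⊆q λ {x} x∈q → decidable-stable (x ∈? p) λ x∉p →
  ℕₚ.<⇒≱ (p⊂q⇒∣p∣<∣q∣ (p⊆q , x , x∈q , x∉p)) q≤p

-- Bases meeting `Z` maximally are recombined in this way, which reflects the direct sum of
-- restriction to `Z` and contraction by `Z`.
mix : ∀ {n} → Subset n → Subset n → Subset n → Subset n
mix Z P Q = (P ∩ Z) ∪ (Q ─ Z)

mix-∩ : ∀ {n} (Z P Q : Subset n) → mix Z P Q ∩ Z ≡ P ∩ Z
mix-∩ [] [] [] = refl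
mix-∩ (true ∷ Z) (true ∷ P) (_ ∷ Q) = cong (true ∷_) (mix-∩ Z P Q)
mix-∩ (true ∷ Z) (false ∷ P) (_ ∷ Q) = cong (false ∷_) (mix-∩ Z P Q)
mix-∩ (false ∷ Z) (true ∷ P) (true ∷ Q) = cong (false ∷_) (mix-∩ Z P Q)
mix-∩ (false ∷ Z) (true ∷ P) (false ∷ Q) = cong (false ∷_) (mix-∩ Z P Q)
mix-∩ (false ∷ Z) (false ∷ P) (true ∷ Q) = cong (false ∷_) (mix-∩ Z P Q)
mix-∩ (false ∷ Z) (false ∷ P) (false ∷ Q) = cong (false ∷_) (mix-∩ Z P Q)

mix-─ : ∀ {n} (Z P Q : Subset n) → mix Z P Q ─ Z ≡ Q ─ Z
mix-─ [] [] [] = refl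
mix-─ (true ∷ Z) (_ ∷ P) (_ ∷ Q) = cong (false ∷_) (mix-─ Z P Q)
mix-─ (false ∷ Z) (true ∷ P) (q ∷ Q) = cong (q ∷_) (mix-─ Z P Q)
mix-─ (false ∷ Z) (false ∷ P) (q ∷ Q) = cong (q ∷_) (mix-─ Z P Q)

mix-refl : ∀ {n} (Z P : Subset n) → mix Z P P ≡ P
mix-refl [] [] = refl
mix-refl (true ∷ Z) (true ∷ P) = cong (true ∷_) (mix-refl Z P)
mix-refl (true ∷ Z) (false ∷ P) = cong (false ∷_) (mix-refl Z P)
mix-refl (false ∷ Z) (true ∷ P) = cong (true ∷_) (mix-refl Z P)
mix-refl (false ∷ Z) (false ∷ P) = cong (false ∷_) (mix-refl Z P)

module _ {n} {Z : Subset n} where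

  ∩∧─⇒≡ : ∀ {p q : Subset n} → p ∩ Z ≡ q ∩ Z → p ─ Z ≡ q ─ Z → p ≡ q
  ∩∧─⇒≡ {p} {q} ∩≡ ─≡ =
    trans (sym (mix-refl Z p)) (trans (cong₂ _∪_ ∩≡ ─≡) (mix-refl Z q))

  ∉-─ : ∀ {p : Subset n} → p ⊆ ∁ Z → p ─ Z ≡ p
  ∉-─ {p} p⊆∁Z = ⊆-antisym (p─q⊆p p Z) λ x∈p → x∈p∧x∉q⇒x∈p─q x∈p (x∈∁p⇒x∉p (p⊆∁Z x∈p))

  mix-∩ˡ : ∀ (P Q : Subset n) → mix Z (P ∩ Z) Q ≡ mix Z P Q
  mix-∩ˡ P Q = cong (_∪ (Q ─ Z)) (trans (∩-assoc P Z Z) (cong (P ∩_) (∩-idem Z)))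

  mix-─ʳ : ∀ (P Q : Subset n) → mix Z P (Q ─ Z) ≡ mix Z P Q
  mix-─ʳ P Q = cong ((P ∩ Z) ∪_) (p─q─q≡p─q Q Z)

  ∈-mix⁻-∈ : ∀ {x} (P Q : Subset n) → x ∈ mix Z P Q → x ∈ Z → x ∈ P
  ∈-mix⁻-∈ {x} P Q x∈ x∈Z = proj₁ (x∈p∩q⁻ P Z (subst (x ∈_) (mix-∩ Z P Q) (x∈p∩q⁺ (x∈ , x∈Z))))

  ∈-mix⁻-∉ : ∀ {x} (P Q : Subset n) → x ∈ mix Z P Q → x ∉ Z → x ∈ Q
  ∈-mix⁻-∉ {x} P Q x∈ x∉Z =
    proj₁ (∈-─⁻ Q Z (subst (x ∈_) (mix-─ Z P Q) (x∈p∧x∉q⇒x∈p─q x∈ x∉Z)))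

  ∈-mix⁺-∈ : ∀ {x} {P} (Q : Subset n) → x ∈ P → x ∈ Z → x ∈ mix Z P Q
  ∈-mix⁺-∈ Q x∈P x∈Z = x∈p∪q⁺ (inj₁ (x∈p∩q⁺ (x∈P , x∈Z)))

  ∈-mix⁺-∉ : ∀ {x} (P : Subset n) {Q} → x ∈ Q → x ∉ Z → x ∈ mix Z P Q
  ∈-mix⁺-∉ P x∈Q x∉Z = x∈p∪q⁺ {p = P ∩ Z} (inj₂ (x∈p∧x∉q⇒x∈p─q x∈Q x∉Z))

  mix-delete : ∀ (P Q : Subset n) {x} → x ∉ Z → mix Z P Q - x ≡ mix Z P (Q - x)
  mix-delete P Q {x} x∉Z = ⊆-antisym to from
    where
    to : mix Z P Q - x ⊆ mix Z P (Q - x)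
    to {k} k∈ with ∈--⁻ (mix Z P Q) k∈ | k ∈? Z
    ... | k∈m , k≢x | yes k∈Z = ∈-mix⁺-∈ (Q - x) (∈-mix⁻-∈ P Q k∈m k∈Z) k∈Z
    ... | k∈m , k≢x | no k∉Z = ∈-mix⁺-∉ P (x∈p∧x≢y⇒x∈p-y (∈-mix⁻-∉ P Q k∈m k∉Z) k≢x) k∉Z
    from : mix Z P (Q - x) ⊆ mix Z P Q - x
    from {k} k∈ with k ∈? Z
    ... | yes k∈Z = x∈p∧x≢y⇒x∈p-y (∈-mix⁺-∈ Q (∈-mix⁻-∈ P (Q - x) k∈ k∈Z) k∈Z) (∈∧∉⇒≢ k∈Z x∉Z)
    ... | no k∉Z with ∈--⁻ Q (∈-mix⁻-∉ P (Q - x) k∈ k∉Z)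
    ...   | k∈Q , k≢x = x∈p∧x≢y⇒x∈p-y (∈-mix⁺-∉ P k∈Q k∉Z) k≢x

-- Order and decidability of the real numbers.

module Tropical (ℝ : Reals) where
  open Reals ℝ renaming (Carrier to R; _≤_ to _≤ᴿ_)
  open Trop ℝ

  private
    module ≈ = IsCommutativeRing isCommutativeRing
    module ≤ = IsTotalOrder isTotalOrder

  +-commutativeMonoid : CommutativeMonoid _ _
  +-commutativeMonoid = record { isCommutativeMonoid = ≈.+-isCommutativeMonoid }

  +-*-ring : Ring _ _
  +-*-ring = record { isRing = ≈.isRing }

  open import Algebra.Properties.Ring +-*-ring using (-‿distribˡ-*; -‿involutive)
  open import Algebra.Solver.CommutativeMonoid +-commutativeMonoid using (solve; _⊜_; _⊕_) renaming (id to ∅)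

  +-mono₂-≤ : ∀ {a b c d} → a ≤ᴿ b → c ≤ᴿ d → a + c ≤ᴿ b + d
  +-mono₂-≤ {a} {b} {c} {d} a≤b c≤d = ≤.trans (+-mono-≤ c a≤b)
    (≤.trans (≤.reflexive (≈.+-comm b c)) (≤.trans (+-mono-≤ b c≤d) (≤.reflexive (≈.+-comm d b))))

  +-cancelʳ : ∀ x c → x + c + - c ≈ x
  +-cancelʳ x c = ≈.trans (≈.+-assoc x c (- c))
    (≈.trans (≈.+-cong ≈.refl (≈.-‿inverseʳ c)) (≈.+-identityʳ x))

  +-cancelʳ-≤ : ∀ {x y} c → x + c ≤ᴿ y + c → x ≤ᴿ y
  +-cancelʳ-≤ {x} {y} c x+c≤y+c = ≤.trans (≤.reflexive (≈.sym (+-cancelʳ x c)))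
    (≤.trans (+-mono-≤ (- c) x+c≤y+c) (≤.reflexive (+-cancelʳ y c)))

  -- The common form of the order arguments: the available inequalities are summed to `A ≤ᴿ B`, and
  -- a monoid identity remains for the solver. The solver knows no negatives; these are treated as
  -- atoms, and `y + - y ≈ 0#` enters as a further summand.
  by-adding : ∀ {A B X Y} → A ≤ᴿ B → X + B ≈ Y + A → X ≤ᴿ Y
  by-adding {A} {B} {X} {Y} A≤B eq = +-cancelʳ-≤ B (≤.trans (≤.reflexive eq)
    (+-mono₂-≤ ≤.refl A≤B))

  -- Splits the cost inequality of an exchange: when one new basis is no cheaper than the old one,
  -- the other is no dearer.
  +-≤-splitˡ : ∀ {a b c d} → a + b ≤ᴿ c + d → d ≤ᴿ b → a ≤ᴿ c
  +-≤-splitˡ le d≤b = by-adding (+-mono₂-≤ le d≤b)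
    (solve 4 (λ a b c d → a ⊕ ((c ⊕ d) ⊕ b) ⊜ c ⊕ ((a ⊕ b) ⊕ d)) ≈.refl _ _ _ _)

  +-≤-splitʳ : ∀ {a b c d} → a + b ≤ᴿ c + d → c ≤ᴿ a → b ≤ᴿ d
  +-≤-splitʳ le c≤a = by-adding (+-mono₂-≤ le c≤a)
    (solve 4 (λ a b c d → b ⊕ ((c ⊕ d) ⊕ a) ⊜ d ⊕ ((a ⊕ b) ⊕ c)) ≈.refl _ _ _ _)

  -- Otherwise `- 1#` would be nonnegative, hence so would its square `1#`, and antisymmetry would
  -- give `0# ≈ 1#`.
  1≰0 : ¬ (1# ≤ᴿ 0#)
  1≰0 1≤0 = 0≉1 (≤.antisym 0≤1 1≤0)
    where
    0≤-1 : 0# ≤ᴿ - 1#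
    0≤-1 = ≤.trans (≤.reflexive (≈.sym (≈.-‿inverseʳ 1#)))
      (≤.trans (+-mono-≤ (- 1#) 1≤0) (≤.reflexive (≈.+-identityˡ _)))
    -1*-1≈1 : - 1# * - 1# ≈ 1#
    -1*-1≈1 = ≈.trans (≈.sym (-‿distribˡ-* 1# (- 1#)))
      (≈.trans (≈.-‿cong (≈.*-identityˡ _)) (-‿involutive 1#))
    0≤1 : 0# ≤ᴿ 1#
    0≤1 = ≤.trans (*-nonneg 0≤-1 0≤-1) (≤.reflexive -1*-1≈1)

  -- The supremum of {0} ∪ {2 | Q} is compared with 1.
  weak-excluded-middle : (Q : Set) → ¬ Q ⊎ ¬ ¬ Q
  weak-excluded-middle Q with sup P (0# , inj₁ ≈.refl) (1# + 1# , bounded)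
    where
    P : R → Set
    P w = (w ≈ 0#) ⊎ ((w ≈ 1# + 1#) × Q)
    bounded : ∀ w → P w → w ≤ᴿ 1# + 1#
    bounded w (inj₂ (w≈2 , _)) = ≤.reflexive w≈2
    bounded w (inj₁ w≈0) with ≤.total 0# 1#
    ... | inj₂ 1≤0 = contradiction 1≤0 1≰0
    ... | inj₁ 0≤1 = ≤.trans (≤.reflexive (≈.trans w≈0 (≈.sym (≈.+-identityˡ 0#)))) (+-mono₂-≤ 0≤1 0≤1)
  ... | s , upper , least with ≤.total s 1#
  ...   | inj₁ s≤1 = inj₁ λ q → 1≰0 (+-cancelʳ-≤ 1# (≤.trans (upper _ (inj₂ (≈.refl , q)))
            (≤.trans s≤1 (≤.reflexive (≈.sym (≈.+-identityˡ 1#))))))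
  ...   | inj₂ 1≤s = inj₂ λ ¬q → 1≰0 (≤.trans 1≤s (least 0# λ where
            _ (inj₁ w≈0) → ≤.reflexive w≈0
            _ (inj₂ (_ , q)) → contradiction q ¬q))

  -- The set {w | ¬ ¬ w ≤ 0} is bounded by 1 and closed under addition, so its
  -- supremum s satisfies s ≤ s - w for each of its elements w.
  ≤0-stable : ∀ z → ¬ ¬ (z ≤ᴿ 0#) → z ≤ᴿ 0#
  ≤0-stable z ¬¬z≤0 with sup P (z , ¬¬z≤0) (1# , bounded)
    where
    P : R → Set
    P w = ¬ ¬ (w ≤ᴿ 0#)
    bounded : ∀ w → P w → w ≤ᴿ 1#
    bounded w pw with ≤.total w 1#
    ... | inj₁ w≤1 = w≤1
    ... | inj₂ 1≤w = ⊥-elim (pw λ w≤0 → 1≰0 (≤.trans 1≤w w≤0))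
  ... | s , upper , least = by-adding s≤s-z
        (≈.trans (≈.trans (≈.+-comm z _) (≈.trans (≈.+-assoc s _ z)
          (≈.trans (≈.+-cong ≈.refl (≈.-‿inverseˡ z)) (≈.+-identityʳ s)))) (≈.sym (≈.+-identityˡ s)))
    where
    s≤s-z : s ≤ᴿ s + - z
    s≤s-z = least (s + - z) λ w pw → ≤.trans (≤.reflexive (≈.sym (+-cancelʳ w z)))
      (+-mono-≤ (- z) (upper (w + z) λ ¬w+z≤0 → pw λ w≤0 → ¬¬z≤0 λ z≤0 →
        ¬w+z≤0 (≤.trans (+-mono₂-≤ w≤0 z≤0) (≤.reflexive (≈.+-identityˡ 0#)))))

  -- Only the doubly negated case needs an argument; stability is known for comparison with `0#`,
  -- hence the passage to `x + - y`.
  _≤?_ : ∀ x y → Dec (x ≤ᴿ y)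
  x ≤? y with weak-excluded-middle (x ≤ᴿ y)
  ... | inj₁ ¬x≤y = no ¬x≤y
  ... | inj₂ ¬¬x≤y = yes (from (≤0-stable (x + - y) λ ¬x-y≤0 → ¬¬x≤y (¬x-y≤0 ∘ to)))
    where
    to : x ≤ᴿ y → x + - y ≤ᴿ 0#
    to x≤y = ≤.trans (+-mono-≤ (- y) x≤y) (≤.reflexive (≈.-‿inverseʳ y))
    from : x + - y ≤ᴿ 0# → x ≤ᴿ y
    from x-y≤0 = +-cancelʳ-≤ (- y) (≤.trans x-y≤0 (≤.reflexive (≈.sym (≈.-‿inverseʳ y))))

  -- Junk value: val ∞ = 0.
  val : 𝕋 → R
  val (fin a) = a
  val ∞ = 0#

  -- Arithmetic and order of tropical numbers.

  finite? : ∀ x → Dec (Finite x)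
  finite? (fin _) = yes λ ()
  finite? ∞ = no λ ∞-finite → ∞-finite refl

  ¬finite⇒∞ : ∀ {x} → ¬ Finite x → x ≡ ∞
  ¬finite⇒∞ {fin _} ¬fin = contradiction (λ ()) ¬fin
  ¬finite⇒∞ {∞} _ = refl

  ⊙-finite : ∀ {x y} → Finite x → Finite y → Finite (x ⊙ y)
  ⊙-finite {fin _} {fin _} _ _ ()
  ⊙-finite {∞} fx _ = contradiction refl fx
  ⊙-finite {fin _} {∞} _ fy = contradiction refl fy

  ⊙-finite⁻ : ∀ {x y} → Finite (x ⊙ y) → Finite x × Finite y
  ⊙-finite⁻ {fin _} {fin _} _ = (λ ()) , λ ()
  ⊙-finite⁻ {∞} f = contradiction refl f
  ⊙-finite⁻ {fin _} {∞} f = contradiction refl f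

  ≤T-finite : ∀ {x y} → x ≤T y → Finite y → Finite x
  ≤T-finite (fin≤fin _) _ = λ ()
  ≤T-finite (_ ≤∞) fy = contradiction refl fy

  ≈T-finite : ∀ {x y} → x ≈T y → Finite x → Finite y
  ≈T-finite (fin≈fin _) _ = λ ()
  ≈T-finite ∞≈∞ f = f

  ≤T-val : ∀ {x y} → x ≤T y → Finite y → val x ≤ᴿ val y
  ≤T-val (fin≤fin a≤b) _ = a≤b
  ≤T-val (_ ≤∞) fy = contradiction refl fy

  val-≤T : ∀ {x y} → Finite x → val x ≤ᴿ val y → x ≤T y
  val-≤T {fin a} {fin b} _ a≤b = fin≤fin a≤b
  val-≤T {fin a} {∞} _ _ = fin a ≤∞
  val-≤T {∞} fx _ = contradiction refl fx

  ≈T-val : ∀ {x y} → x ≈T y → val x ≈ val y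
  ≈T-val (fin≈fin a≈b) = a≈b
  ≈T-val ∞≈∞ = ≈.refl

  val-≈T : ∀ {x y} → Finite x → Finite y → val x ≈ val y → x ≈T y
  val-≈T {fin _} {fin _} _ _ a≈b = fin≈fin a≈b
  val-≈T {fin _} {∞} _ fy _ = contradiction refl fy
  val-≈T {∞} fx _ _ = contradiction refl fx

  val-⊙ : ∀ {x y} → Finite x → Finite y → val (x ⊙ y) ≡ val x + val y
  val-⊙ {fin _} {fin _} _ _ = refl
  val-⊙ {∞} fx _ = contradiction refl fx
  val-⊙ {fin _} {∞} _ fy = contradiction refl fy

  -- A finite right-hand side forces both factors on the left to be finite, so the inequality
  -- descends to the reals.
  ⊙-≤T⁻ : ∀ {a b c d} → Finite c → Finite d → a ⊙ b ≤T c ⊙ d →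
    Finite a × Finite b × val a + val b ≤ᴿ val c + val d
  ⊙-≤T⁻ fc fd le with ⊙-finite⁻ (≤T-finite le (⊙-finite fc fd))
  ... | fa , fb = fa , fb , subst₂ _≤ᴿ_ (val-⊙ fa fb) (val-⊙ fc fd) (≤T-val le (⊙-finite fc fd))

  ⊙-≤T⁺ : ∀ {a b c d} → Finite a → Finite b → Finite c → Finite d →
    val a + val b ≤ᴿ val c + val d → a ⊙ b ≤T c ⊙ d
  ⊙-≤T⁺ fa fb fc fd le = val-≤T (⊙-finite fa fb) (subst₂ _≤ᴿ_ (sym (val-⊙ fa fb)) (sym (val-⊙ fc fd)) le)

  ⊙-≤T-comm : ∀ {a b c d} → Finite (c ⊙ d) → a ⊙ b ≤T c ⊙ d → b ⊙ a ≤T d ⊙ c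
  ⊙-≤T-comm fcd le with ⊙-finite⁻ fcd
  ... | fc , fd with ⊙-≤T⁻ fc fd le
  ...   | fa , fb , le′ = ⊙-≤T⁺ fb fa fd fc (≤.trans (≤.reflexive (≈.+-comm _ _))
            (≤.trans le′ (≤.reflexive (≈.+-comm _ _))))

  ≤T-total : Total _≤T_
  ≤T-total x ∞ = inj₁ (x ≤∞)
  ≤T-total ∞ y = inj₂ (y ≤∞)
  ≤T-total (fin a) (fin b) = [ inj₁ ∘ fin≤fin , inj₂ ∘ fin≤fin ]′ (≤.total a b)

  ≤T-trans : Transitive _≤T_
  ≤T-trans {x} _ (_ ≤∞) = x ≤∞
  ≤T-trans (fin≤fin a≤b) (fin≤fin b≤c) = fin≤fin (≤.trans a≤b b≤c)

  _≤T?_ : ∀ x y → Dec (x ≤T y)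
  x ≤T? ∞ = yes (x ≤∞)
  ∞ ≤T? fin _ = no λ ()
  fin a ≤T? fin b = map′ fin≤fin (λ { (fin≤fin a≤b) → a≤b }) (a ≤? b)

  -- For a finite index set, the minimum is attained twice iff no finite entry
  -- is strictly smaller than all the others.
  Balanced : {A : Set} → (A → Set) → (A → 𝕋) → Set
  Balanced P v = ∀ a → P a → Finite (v a) → ∃[ b ] (b ≢ a × P b × v b ≤T v a)

  -- Of two distinct minimising indices at least one differs from the given one.
  minTwice⇒balanced : ∀ {A : Set} {P : A → Set} {v} → DecidableEquality A →
    MinTwice P v → Balanced P v
  minTwice⇒balanced _ (inj₁ all∞) a pa fa = contradiction (all∞ a pa) fa
  minTwice⇒balanced _≟′_ (inj₂ (b , c , pb , pc , b≢c , min)) a pa fa with b ≟′ a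
  ... | no b≢a = b , b≢a , pb , proj₁ (min a pa)
  ... | yes refl = c , b≢c ∘ sym , pc , proj₂ (min a pa)

  -- A minimising index of the enumeration is one of the two, and balance supplies the other; if its
  -- value is `∞`, all values are.
  balanced⇒minTwice : ∀ {A : Set} {P : A → Set} {v} (l : List A) → (∀ a → a ∈ₗ l) → Decidable P →
    Balanced P v → MinTwice P v
  balanced⇒minTwice {v = v} l ∈l P? bal with argmin-list ≤T-total ≤T-trans v P? l
  ... | inj₁ none = inj₁ λ a pa → contradiction pa (none a (∈l a))
  ... | inj₂ (m , pm , min) with finite? (v m)
  ...   | no ¬fm = inj₁ λ a pa → ¬finite⇒∞ λ fa → ¬fm (≤T-finite (min a (∈l a) pa) fa)
  ...   | yes fm with bal m pm fm
  ...     | b , b≢m , pb , vb≤vm = inj₂ (m , b , pm , pb , b≢m ∘ sym , λ c pc →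
              min c (∈l c) pc , ≤T-trans vb≤vm (min c (∈l c) pc))

  -- Exchange of a single element.

  sum-insert : ∀ {n} (u : Fin n → R) (p : Subset n) x → x ∉ p →
    ⟨ u ,e p ∪ ⁅ x ⁆ ⟩ ≈ ⟨ u ,e p ⟩ + u x
  sum-insert u (true ∷ p) zero x∉p = contradiction here x∉p
  sum-insert u (false ∷ p) zero x∉p rewrite ∪-identityʳ p =
    ≈.trans (≈.+-comm _ _) (≈.+-cong (≈.sym (≈.+-identityˡ _)) ≈.refl)
  sum-insert u (true ∷ p) (suc x) x∉p =
    ≈.trans (≈.+-cong ≈.refl (sum-insert (u ∘ suc) p x (x∉p ∘ there))) (≈.sym (≈.+-assoc _ _ _))
  sum-insert u (false ∷ p) (suc x) x∉p =
    ≈.trans (≈.+-cong ≈.refl (sum-insert (u ∘ suc) p x (x∉p ∘ there))) (≈.sym (≈.+-assoc _ _ _))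

  module _ {n : ℕ} where

    -- The form without subtraction is the one that the monoid solver can use.
    sum-swap : ∀ (u : Fin n → R) {B i j} → i ∈ B → j ∉ B →
      ⟨ u ,e swap B i j ⟩ + u i ≈ ⟨ u ,e B ⟩ + u j
    sum-swap u {B} {i} {j} i∈B j∉B =
      ≈.trans (≈.+-cong (sum-insert u (B - i) j (j∉B ∘ proj₁ ∘ ∈--⁻ B)) ≈.refl)
      (≈.trans (solve 3 (λ a b c → (a ⊕ b) ⊕ c ⊜ (a ⊕ c) ⊕ b) ≈.refl _ _ _)
      (≈.+-cong (≈.trans (≈.sym (sum-insert u (B - i) i (∉- B)))
        (≈.reflexive (cong (λ C → ⟨ u ,e C ⟩) (insert-delete i∈B)))) ≈.refl))

    ∣swap∣ : ∀ {B : Subset n} {i j} → i ∈ B → j ∉ B → ∣ swap B i j ∣ ≡ ∣ B ∣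
    ∣swap∣ {B} {i} {j} i∈B j∉B = trans (∣insert∣ (B - i) j (j∉B ∘ proj₁ ∘ ∈--⁻ B)) (∣delete∣ i∈B)

    ∈-swap-new : ∀ (B : Subset n) i j → j ∈ swap B i j
    ∈-swap-new B i j = ∈-∪⁅⁆ʳ (B - i) j

    ∈-swap-old : ∀ {B : Subset n} {i} j {k} → k ∈ B → k ≢ i → k ∈ swap B i j
    ∈-swap-old j k∈B k≢i = ∈-∪⁅⁆ˡ j (x∈p∧x≢y⇒x∈p-y k∈B k≢i)

    ∈-swap⁻ : ∀ (B : Subset n) {i j k} → k ∈ swap B i j → (k ∈ B × k ≢ i) ⊎ k ≡ j
    ∈-swap⁻ B {i} k∈ = [ inj₁ ∘ ∈--⁻ B , inj₂ ]′ (∈-∪⁅⁆⁻ (B - i) k∈)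

    ∉-swap : ∀ (B : Subset n) {i j} → i ≢ j → i ∉ swap B i j
    ∉-swap B i≢j i∈ = [ (λ i∈B → proj₂ i∈B refl) , i≢j ]′ (∈-swap⁻ B i∈)

    swap-swap : ∀ {B : Subset n} {i j} → i ∈ B → j ∉ B → swap (swap B i j) j i ≡ B
    swap-swap {B} {i} i∈B j∉B =
      trans (cong (_∪ ⁅ i ⁆) (delete-insert (j∉B ∘ proj₁ ∘ ∈--⁻ B))) (insert-delete i∈B)

    swap-delete : ∀ {J : Subset n} {a j} → a ∈ J → j ≢ a → swap (J - a) j a ≡ J - j
    swap-delete {J} {a} {j} a∈J j≢a =
      trans (delete-insert-comm (J - a) j≢a) (cong (_- j) (insert-delete a∈J))

    bases? : ∀ μ r → Decidable (Bases {n} μ r)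
    bases? μ r I = (∣ I ∣ ℕₚ.≟ r) ×-dec finite? (μ I)

    -- Exchange and Plücker relations

    module _ {μ : Subset n → 𝕋} {r : ℕ} {ν : Subset n → 𝕋} {s : ℕ} where

      -- The right-hand side is finite, so both swapped sets have finite value; as swaps preserve
      -- cardinality, they are again bases.
      exchange : ValuatedQuotient μ r ν s → ∀ {I J i} → Bases μ r I → Bases ν s J → i ∈ I → i ∉ J →
        ∃[ j ] (j ∈ J × j ∉ I × Bases μ r (swap I i j) × Bases ν s (swap J j i) ×
                val (μ (swap I i j)) + val (ν (swap J j i)) ≤ᴿ val (μ I) + val (ν J))
      exchange vq {I} {J} {i} bI bJ i∈I i∉J with vq I J bI bJ i i∈I i∉J
      ... | j , j∈J , j∉I , le with ⊙-≤T⁻ (proj₂ bI) (proj₂ bJ) le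
      ...   | f₁ , f₂ , le′ = j , j∈J , j∉I , (trans (∣swap∣ i∈I j∉I) (proj₁ bI) , f₁) ,
                              (trans (∣swap∣ j∈J i∉J) (proj₁ bJ) , f₂) , le′

      -- Exchange of `a` between `I′ ∪ ⁅ a ⁆` and `J′ - a`: the partner `j` yields `I′ ∪ ⁅ j ⁆` and
      -- `J′ - j`, the term of the required second index.
      quotient⇒balanced : ValuatedQuotient μ r ν s → ∀ I′ J′ → suc ∣ I′ ∣ ≡ r → ∣ J′ ∣ ≡ suc s →
        Balanced (λ j → j ∈ J′ × j ∉ I′) (λ j → μ (I′ ∪ ⁅ j ⁆) ⊙ ν (J′ - j))
      quotient⇒balanced vq I′ J′ ∣I′∣ ∣J′∣ a (a∈J′ , a∉I′) fa
        with vq (I′ ∪ ⁅ a ⁆) (J′ - a)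
               (trans (∣insert∣ I′ a a∉I′) ∣I′∣ , proj₁ (⊙-finite⁻ fa))
               (ℕₚ.suc-injective (trans (∣delete∣ a∈J′) ∣J′∣) , proj₂ (⊙-finite⁻ fa))
               a (∈-∪⁅⁆ʳ I′ a) (∉- J′)
      ... | j , j∈J , j∉I , le = j , j≢a , (proj₁ (∈--⁻ J′ j∈J) , j∉I ∘ ∈-∪⁅⁆ˡ a) ,
        subst₂ (λ A B → μ (A ∪ ⁅ j ⁆) ⊙ ν B ≤T μ (I′ ∪ ⁅ a ⁆) ⊙ ν (J′ - a))
          (delete-insert a∉I′) (swap-delete a∈J′ j≢a) le
        where
        j≢a : j ≢ a
        j≢a = proj₂ (∈--⁻ J′ j∈J)

      quotient⇒incidence : ValuatedQuotient μ r ν s → IncidencePlucker μ r ν s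
      quotient⇒incidence vq I′ J′ ∣I′∣ ∣J′∣ = balanced⇒minTwice (List.allFin n) ∈-allFin
        (λ j → (j ∈? J′) ×-dec ¬? (j ∈? I′)) (quotient⇒balanced vq I′ J′ ∣I′∣ ∣J′∣)

      -- At index `i` the incidence term is `μ I ⊙ ν J`; another index doing at least as well is an
      -- exchange partner.
      incidence⇒quotient : IncidencePlucker μ r ν s → ValuatedQuotient μ r ν s
      incidence⇒quotient ip I J (∣I∣ , fI) (∣J∣ , fJ) i i∈I i∉J
        with minTwice⇒balanced _≟_
               (ip (I - i) (J ∪ ⁅ i ⁆) (trans (∣delete∣ i∈I) ∣I∣) (trans (∣insert∣ J i i∉J) (cong suc ∣J∣)))
               i (∈-∪⁅⁆ʳ J i , ∉- I)
               (subst₂ (λ A B → Finite (μ A ⊙ ν B)) (sym (insert-delete i∈I)) (sym (delete-insert i∉J))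
                 (⊙-finite fI fJ))
      ... | j , j≢i , (j∈ , j∉) , le =
        j , [ id , (λ j≡i → contradiction j≡i j≢i) ]′ (∈-∪⁅⁆⁻ J j∈) ,
        (λ j∈I → j∉ (x∈p∧x≢y⇒x∈p-y j∈I j≢i)) ,
        subst (λ B → μ (swap I i j) ⊙ ν B ≤T μ I ⊙ ν J) (sym (delete-insert-comm J j≢i))
          (subst₂ (λ A B → μ (swap I i j) ⊙ ν ((J ∪ ⁅ i ⁆) - j) ≤T μ A ⊙ ν B)
            (insert-delete i∈I) (delete-insert i∉J) le)

    -- The Grassmann–Plücker relation of I, J, i is the incidence relation of
    -- I - i and J + i, the index i being called nothing.
    quotient⇒grassmann : ∀ {μ r} → ValuatedQuotient {n} μ r μ r → GrassmannPlucker μ r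
    quotient⇒grassmann {μ} {r} vq I J ∣I∣ ∣J∣ _ i i∈I i∉J =
      balanced⇒minTwice (nothing ∷ List.map just (List.allFin n))
        (λ { nothing → here refl ; (just j) → there (∈-map⁺ just (∈-allFin j)) })
        (λ { nothing → yes tt ; (just j) → (j ∈? J) ×-dec ¬? (j ∈? I) })
        λ { nothing _ f → from-i f ; (just j) (j∈J , j∉I) f → from-j j∈J j∉I f }
      where
      v : Fin n → 𝕋
      v j = μ ((I - i) ∪ ⁅ j ⁆) ⊙ μ ((J ∪ ⁅ i ⁆) - j)
      bal : Balanced (λ j → j ∈ J ∪ ⁅ i ⁆ × j ∉ I - i) v
      bal = quotient⇒balanced vq (I - i) (J ∪ ⁅ i ⁆)
              (trans (∣delete∣ i∈I) ∣I∣) (trans (∣insert∣ J i i∉J) (cong suc ∣J∣))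
      v-i : v i ≡ μ I ⊙ μ J
      v-i = cong₂ (λ A B → μ A ⊙ μ B) (insert-delete i∈I) (delete-insert i∉J)
      v-j : ∀ {j} → j ≢ i → v j ≡ μ (swap I i j) ⊙ μ (swap J j i)
      v-j {j} j≢i = cong (λ B → μ (swap I i j) ⊙ μ B) (sym (delete-insert-comm J j≢i))
      other : ∀ {j} → j ≢ i → j ∈ J ∪ ⁅ i ⁆ → j ∉ I - i → j ∈ J × j ∉ I
      other j≢i j∈ j∉ = [ id , (λ j≡i → contradiction j≡i j≢i) ]′ (∈-∪⁅⁆⁻ J j∈) ,
                        λ j∈I → j∉ (x∈p∧x≢y⇒x∈p-y j∈I j≢i)
      from-i : Finite (μ I ⊙ μ J) → _
      from-i f with bal i (∈-∪⁅⁆ʳ J i , ∉- I) (subst Finite (sym v-i) f)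
      ... | j , j≢i , (j∈ , j∉) , le = just j , (λ ()) , other j≢i j∈ j∉ , subst₂ _≤T_ (v-j j≢i) v-i le
      from-j : ∀ {j} → j ∈ J → j ∉ I → Finite (μ (swap I i j) ⊙ μ (swap J j i)) → _
      from-j {j} j∈J j∉I f
        with bal j (∈-∪⁅⁆ˡ i j∈J , j∉I ∘ proj₁ ∘ ∈--⁻ I) (subst Finite (sym (v-j (∈∧∉⇒≢ j∈J i∉J))) f)
      ... | k , k≢j , (k∈ , k∉) , le with k ≟ i
      ...   | yes refl = nothing , (λ ()) , tt , subst₂ _≤T_ v-i (v-j (∈∧∉⇒≢ j∈J i∉J)) le
      ...   | no k≢i = just k , (λ { refl → k≢j refl }) , other k≢i k∈ k∉ ,
                       subst₂ _≤T_ (v-j k≢i) (v-j (∈∧∉⇒≢ j∈J i∉J)) le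

    -- Minimisers of tilted valuations

    -- Real-valued through `val`, hence significant only where `μ` is finite.
    cost : (Fin n → R) → (Subset n → 𝕋) → Subset n → R
    cost u μ B = val (μ B) + ⟨ u ,e B ⟩

    MinBase : (Fin n → R) → (Subset n → 𝕋) → ℕ → Subset n → Set
    MinBase u μ r B = Bases μ r B × (∀ B′ → Bases μ r B′ → cost u μ B ≤ᴿ cost u μ B′)

    minBase? : ∀ u μ r → Decidable (MinBase u μ r)
    minBase? u μ r B = bases? μ r B ×-dec
      allSubset? λ B′ → implies? (bases? μ r B′) (cost u μ B ≤? cost u μ B′)

    minBase-exists : ∀ u {μ r} → ∃ (Bases μ r) → ∃ (MinBase u μ r)
    minBase-exists u {μ} {r} = argmin ≤.total ≤.trans (cost u μ) (bases? μ r)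

    -- The linear parts of the two swaps cancel: what `I` gains in passing from `i` to `j`, `J`
    -- loses. Hence exchange survives tilting.
    cost-swap : ∀ u (μ ν : Subset n → 𝕋) {I J i j} → i ∈ I → i ∉ J → j ∈ J → j ∉ I →
      val (μ (swap I i j)) + val (ν (swap J j i)) ≤ᴿ val (μ I) + val (ν J) →
      cost u μ (swap I i j) + cost u ν (swap J j i) ≤ᴿ cost u μ I + cost u ν J
    cost-swap u μ ν i∈I i∉J j∈J j∉I le = by-adding
      (+-mono₂-≤ le (+-mono₂-≤ (≤.reflexive (sum-swap u i∈I j∉I)) (≤.reflexive (sum-swap u j∈J i∉J))))
      (solve 10 (λ m₀ m₁ n₀ n₁ U₀ U₁ V₀ V₁ a b →
          ((m₁ ⊕ U₁) ⊕ (n₁ ⊕ V₁)) ⊕ ((m₀ ⊕ n₀) ⊕ ((U₀ ⊕ b) ⊕ (V₀ ⊕ a)))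
        ⊜ ((m₀ ⊕ U₀) ⊕ (n₀ ⊕ V₀)) ⊕ ((m₁ ⊕ n₁) ⊕ ((U₁ ⊕ a) ⊕ (V₁ ⊕ b))))
        ≈.refl _ _ _ _ _ _ _ _ _ _)

    -- The swapped pair costs no more in total than the two minima, and neither member costs less
    -- than its own minimum.
    minBase-exchange : ∀ u {μ r ν s} → ValuatedQuotient μ r ν s → ∀ {I J i} →
      MinBase u μ r I → MinBase u ν s J → i ∈ I → i ∉ J →
      ∃[ j ] (j ∈ J × j ∉ I × MinBase u μ r (swap I i j) × MinBase u ν s (swap J j i))
    minBase-exchange u {μ} {ν = ν} vq (bI , minI) (bJ , minJ) i∈I i∉J with exchange vq bI bJ i∈I i∉J
    ... | j , j∈J , j∉I , bI₁ , bJ₁ , le = j , j∈J , j∉I ,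
      (bI₁ , λ B bB → ≤.trans (+-≤-splitˡ le′ (minJ _ bJ₁)) (minI B bB)) ,
      (bJ₁ , λ B bB → ≤.trans (+-≤-splitʳ le′ (minI _ bI₁)) (minJ B bB))
      where le′ = cost-swap u μ ν i∈I i∉J j∈J j∉I le

    independent? : ∀ {𝓑 : Subset n → Set} → Decidable 𝓑 → Decidable (Independent 𝓑)
    independent? 𝓑? X = anySubset? λ B → 𝓑? B ×-dec (X ⊆? B)

    -- Extend C - e to a basis J of 𝓒 and choose X maximal among the independent
    -- sets of 𝓑 inside C - e.  If X + e were contained in a basis I of 𝓑, then
    -- exchanging e ∈ I for some j ∈ J would force j ∈ C - e and make X + j
    -- independent.  So X + e contains a circuit, which passes through e.
    exchange⇒matroidQuotient : ∀ {𝓑 𝓒 : Subset n → Set} → Decidable 𝓑 → ∃ 𝓑 →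
      (∀ {I J i} → 𝓑 I → 𝓒 J → i ∈ I → i ∉ J →
         ∃[ j ] (j ∈ J × j ∉ I × 𝓑 (swap I i j) × 𝓒 (swap J j i))) →
      MatroidQuotient 𝓑 𝓒
    exchange⇒matroidQuotient {𝓑} {𝓒} 𝓑? (B₀ , bB₀) exch C (depC , indC) e e∈C
      with indC (C - e) (x∈p⇒p-x⊂p e∈C)
         | argmin {_≼_ = ℕ._≥_} (λ a b → ℕₚ.≤-total b a) (λ p q → ℕₚ.≤-trans q p) ∣_∣
             (λ X → (X ⊆? (C - e)) ×-dec independent? 𝓑? X) (_ , ⊥⊆ , B₀ , bB₀ , ⊥⊆)
    ... | J , cJ , C-e⊆J | X , (X⊆C-e , B , bB , X⊆B) , maxX with independent? 𝓑? (X ∪ ⁅ e ⁆)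
    ...   | yes (I , bI , X+e⊆I) = ⊥-elim (ℕₚ.1+n≰n (ℕₚ.≤-trans (ℕₚ.≤-reflexive (sym (∣insert∣ X j j∉X)))
              (maxX (X ∪ ⁅ j ⁆) (X+j⊆C-e , swap I e j , bI₁ , X+j⊆I₁))))
      where
      C⊆ : ∀ {K} → e ∈ K → C - e ⊆ K → C ⊆ K
      C⊆ e∈K C-e⊆K {k} k∈C with k ≟ e
      ... | yes refl = e∈K
      ... | no k≢e = C-e⊆K (x∈p∧x≢y⇒x∈p-y k∈C k≢e)
      exchanged = exch bI cJ (X+e⊆I (∈-∪⁅⁆ʳ X e)) (λ e∈J → depC (J , cJ , C⊆ e∈J C-e⊆J))
      j = proj₁ exchanged
      j∉I = proj₁ (proj₂ (proj₂ exchanged))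
      bI₁ = proj₁ (proj₂ (proj₂ (proj₂ exchanged)))
      cJ₁ = proj₂ (proj₂ (proj₂ (proj₂ exchanged)))
      j∈C-e : j ∈ C - e
      j∈C-e = decidable-stable (j ∈? (C - e)) λ j∉C-e → depC (swap J j e , cJ₁ ,
        C⊆ (∈-swap-new J j e) λ k∈ → ∈-swap-old e (C-e⊆J k∈) (∈∧∉⇒≢ k∈ j∉C-e))
      j∉X : j ∉ X
      j∉X j∈X = j∉I (X+e⊆I (∈-∪⁅⁆ˡ e j∈X))
      X+j⊆C-e : X ∪ ⁅ j ⁆ ⊆ C - e
      X+j⊆C-e k∈ = [ X⊆C-e , (λ { refl → j∈C-e }) ]′ (∈-∪⁅⁆⁻ X k∈)
      X+j⊆I₁ : X ∪ ⁅ j ⁆ ⊆ swap I e j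
      X+j⊆I₁ k∈ = [ (λ k∈X → ∈-swap-old j (X+e⊆I (∈-∪⁅⁆ˡ e k∈X)) (proj₂ (∈--⁻ C (X⊆C-e k∈X))))
                  , (λ { refl → ∈-swap-new I e j }) ]′ (∈-∪⁅⁆⁻ X k∈)
    -- A dependent subset of `X ∪ ⁅ e ⁆` of least size is a circuit; it contains `e` because `X`
    -- lies in the basis `B`.
    ...   | no depX+e with argmin ℕₚ.≤-total ℕₚ.≤-trans ∣_∣
                             (λ D → (D ⊆? (X ∪ ⁅ e ⁆)) ×-dec ¬? (independent? 𝓑? D)) (_ , id , depX+e)
    ...     | D , (D⊆X+e , depD) , minD = D , (depD , indD) ,
              (λ k∈D → [ (λ k∈X → proj₁ (∈--⁻ C (X⊆C-e k∈X))) , (λ { refl → e∈C }) ]′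
                         (∈-∪⁅⁆⁻ X (D⊆X+e k∈D))) ,
              decidable-stable (e ∈? D) λ e∉D → depD (B , bB , λ k∈D →
                [ X⊆B , (λ { refl → contradiction k∈D e∉D }) ]′ (∈-∪⁅⁆⁻ X (D⊆X+e k∈D)))
      where
      indD : ∀ Y → Y ⊂ D → Independent 𝓑 Y
      indD Y Y⊂D = decidable-stable (independent? 𝓑? Y) λ depY →
        ℕₚ.<⇒≱ (p⊂q⇒∣p∣<∣q∣ Y⊂D) (minD Y (D⊆X+e ∘ proj₁ Y⊂D , depY))

  -- Reduction of the total weight to the single components.

  ⊙-mono-≤T : ∀ {a b c d} → a ≤T b → c ≤T d → a ⊙ c ≤T b ⊙ d
  ⊙-mono-≤T (fin≤fin p) (fin≤fin q) = fin≤fin (+-mono₂-≤ p q)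
  ⊙-mono-≤T (fin≤fin _) (_ ≤∞) = _ ≤∞
  ⊙-mono-≤T (_ ≤∞) _ = _ ≤∞

  sumT-mono : ∀ {k} {f g : Fin k → 𝕋} → (∀ i → f i ≤T g i) → sumT f ≤T sumT g
  sumT-mono {zero} _ = fin≤fin ≤.refl
  sumT-mono {suc k} f≤g = ⊙-mono-≤T (f≤g zero) (sumT-mono (f≤g ∘ suc))

  sumT-finite : ∀ {k} {f : Fin k → 𝕋} → (∀ i → Finite (f i)) → Finite (sumT f)
  sumT-finite {zero} _ ()
  sumT-finite {suc k} fin-f = ⊙-finite (fin-f zero) (sumT-finite (fin-f ∘ suc))

  sumT-cong : ∀ {k} {f g : Fin k → 𝕋} → (∀ i → f i ≡ g i) → sumT f ≡ sumT g
  sumT-cong {zero} _ = refl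
  sumT-cong {suc k} f≡g = cong₂ _⊙_ (f≡g zero) (sumT-cong (f≡g ∘ suc))

  -- The terms on which the families agree are finite, hence can be cancelled.
  sumT-cancel : ∀ {k} {f g : Fin k → 𝕋} c → (∀ i → Finite (f i)) → (∀ i → Finite (g i)) →
    (∀ i → i ≢ c → f i ≡ g i) → sumT f ≤T sumT g → val (f c) ≤ᴿ val (g c)
  sumT-cancel zero ff fg f≡g le
    with ⊙-≤T⁻ (fg zero) (sumT-finite (fg ∘ suc)) le
  ... | _ , _ , le′ = +-≤-splitˡ le′ (≤.reflexive (≈.reflexive (cong val (sym (sumT-cong λ i → f≡g (suc i) λ ())))))
  sumT-cancel (suc c) ff fg f≡g le
    with ⊙-≤T⁻ (fg zero) (sumT-finite (fg ∘ suc)) le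
  ... | _ , _ , le′ = sumT-cancel c (ff ∘ suc) (fg ∘ suc) (λ i i≢c → f≡g (suc i) λ { refl → i≢c refl })
        (val-≤T (sumT-finite (ff ∘ suc))
          (+-≤-splitʳ le′ (≤.reflexive (≈.reflexive (cong val (sym (f≡g zero λ ())))))))

  module _ {n k : ℕ} (r : Fin k → ℕ) (μ : Fin k → Subset n → 𝕋) (u : Fin n → R) where

    private
      term : (Fin k → Subset n) → Fin k → 𝕋
      term B i = μ i (B i) ⊙ fin ⟨ u ,e B i ⟩

      term-finite : ∀ {B} → (∀ i → Bases (μ i) (r i) (B i)) → ∀ i → Finite (term B i)
      term-finite bB i = ⊙-finite (proj₂ (bB i)) λ ()

      val-term : ∀ {B} → (∀ i → Bases (μ i) (r i) (B i)) → ∀ i → val (term B i) ≡ cost u (μ i) (B i)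
      val-term bB i = val-⊙ (proj₂ (bB i)) λ ()

    minBases⇒isMinimizer : ∀ {B} → (∀ i → MinBase u (μ i) (r i) (B i)) → IsMinimizer r μ u B
    minBases⇒isMinimizer {B} minB = proj₁ ∘ minB , λ B′ bB′ → sumT-mono λ i →
      val-≤T (term-finite (proj₁ ∘ minB) i)
        (subst₂ _≤ᴿ_ (sym (val-term (proj₁ ∘ minB) i)) (sym (val-term bB′ i)) (proj₂ (minB i) (B′ i) (bB′ i)))

    -- Optimality at `c` is tested against tuples altered at `c` only; the remaining terms cancel.
    isMinimizer⇒minBases : ∀ {B} → IsMinimizer r μ u B → ∀ i → MinBase u (μ i) (r i) (B i)
    isMinimizer⇒minBases {B} (bB , minB) c = bB c , λ B″ bB″ →
      let B′ = updateAt B c (λ _ → B″)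
          bB′ = updateAt-all {P = λ i → Bases (μ i) (r i)} bB bB″
      in subst₂ _≤ᴿ_ (val-term bB c)
           (trans (val-term bB′ c) (cong (cost u (μ c)) (updateAt-updates c B)))
           (sumT-cancel c (term-finite bB) (term-finite bB′)
             (λ i i≢c → cong (λ D → μ i D ⊙ fin ⟨ u ,e D ⟩) (sym (updateAt-minimal i c B i≢c)))
             (minB B′ bB′))

  -- Weights separating the two sets of a failed exchange.

  module _ {n : ℕ} where

    cost-≤-swap : ∀ (u : Fin n → R) (μ : Subset n → 𝕋) {B i j} → i ∈ B → j ∉ B →
      val (μ B) + u i ≤ᴿ val (μ (swap B i j)) + u j → cost u μ B ≤ᴿ cost u μ (swap B i j)
    cost-≤-swap u μ i∈B j∉B le = by-adding (+-mono₂-≤ le (≤.reflexive (≈.sym (sum-swap u i∈B j∉B))))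
      (solve 6 (λ b s U V a c → (b ⊕ U) ⊕ ((s ⊕ c) ⊕ (V ⊕ a)) ⊜ (s ⊕ V) ⊕ ((b ⊕ a) ⊕ (U ⊕ c)))
        ≈.refl _ _ _ _ _ _)

    cost-swap-≤ : ∀ (u : Fin n → R) (μ : Subset n → 𝕋) {B i j} → i ∈ B → j ∉ B →
      cost u μ (swap B i j) ≤ᴿ cost u μ B → val (μ (swap B i j)) + u j ≤ᴿ val (μ B) + u i
    cost-swap-≤ u μ i∈B j∉B le = by-adding (+-mono₂-≤ le (≤.reflexive (≈.sym (sum-swap u i∈B j∉B))))
      (solve 6 (λ b s U V a c → (s ⊕ c) ⊕ ((b ⊕ U) ⊕ (V ⊕ a)) ⊜ (b ⊕ a) ⊕ ((s ⊕ V) ⊕ (U ⊕ c)))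
        ≈.refl _ _ _ _ _ _)

    module _ {μ ν : Subset n → 𝕋} {I J : Subset n} {e : Fin n}
             (fI : Finite (μ I)) (fJ : Finite (ν J)) (e∈I : e ∈ I) (e∉J : e ∉ J)
             (no-exchange : ∀ j → j ∈ J → j ∉ I →
                ¬ (μ (swap I e j) ⊙ ν (swap J j e) ≤T μ I ⊙ ν J)) where

      private
        -- Admissible weights `x` at `k`, normalised to zero at `e`. The lower bound says that
        -- replacing `e` by `k` does not make `I` cheaper, the strict upper bound that replacing `k`
        -- by `e` makes `J` dearer. The bounds are compatible precisely because exchange fails at
        -- `k`.
        Pick : Fin n → R → Set
        Pick k x =
          (k ≡ e → x ≡ 0#) ×
          (k ∉ I → Finite (μ (swap I e k)) → val (μ I) ≤ᴿ val (μ (swap I e k)) + x) ×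
          (k ∈ J → Finite (ν (swap J k e)) → ¬ (val (ν (swap J k e)) ≤ᴿ val (ν J) + x))

        pick-above : ∀ k → k ≢ e → (k ∉ I → ¬ Finite (μ (swap I e k))) → ∃ (Pick k)
        -- The lower bound is void; the weight lies one unit below the upper bound.
        pick-above k k≢e never = val (ν (swap J k e)) + - (val (ν J) + 1#) ,
          (λ k≡e → contradiction k≡e k≢e) , (λ k∉I f → contradiction f (never k∉I)) ,
          λ _ _ le → 1≰0 (by-adding (+-mono₂-≤ le (≤.reflexive (≈.-‿inverseʳ (val (ν J) + 1#))))
            (solve 4 (λ y j i z → i ⊕ ((j ⊕ (y ⊕ z)) ⊕ ∅) ⊜ ∅ ⊕ (y ⊕ ((j ⊕ i) ⊕ z)))
              ≈.refl _ _ _ _))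

        pick : ∀ k → ∃ (Pick k)
        pick k with k ≟ e
        ... | yes refl = 0# , (λ _ → refl) , (λ e∉I → contradiction e∈I e∉I) , λ e∈J → contradiction e∈J e∉J
        ... | no k≢e with k ∈? I | finite? (μ (swap I e k))
        ...   | yes k∈I | _ = pick-above k k≢e λ k∉I → contradiction k∈I k∉I
        ...   | no _ | no ¬f = pick-above k k≢e λ _ → ¬f
        -- The weight is the lower bound itself; if it violated the upper bound, `k` would be an
        -- exchange partner.
        ...   | no k∉I | yes f = val (μ I) + - val (μ (swap I e k)) , (λ k≡e → contradiction k≡e k≢e) ,
          (λ _ _ → ≤.reflexive (≈.sym (≈.trans (≈.+-comm _ _) (≈.trans (≈.+-assoc _ _ _)
            (≈.trans (≈.+-cong ≈.refl (≈.-‿inverseˡ _)) (≈.+-identityʳ _)))))) ,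
          λ k∈J g le → no-exchange k k∈J k∉I (⊙-≤T⁺ f g fI fJ (by-adding
            (+-mono₂-≤ le (≤.reflexive (≈.-‿inverseʳ (val (μ (swap I e k))))))
            (solve 5 (λ m₁ n₁ m₀ n₀ z →
                (m₁ ⊕ n₁) ⊕ ((n₀ ⊕ (m₀ ⊕ z)) ⊕ ∅) ⊜ (m₀ ⊕ n₀) ⊕ (n₁ ⊕ (m₁ ⊕ z)))
              ≈.refl _ _ _ _ _)))

      separating-weight : ∃[ u ]
        ((∀ j → j ∉ I → Finite (μ (swap I e j)) → val (μ I) + u e ≤ᴿ val (μ (swap I e j)) + u j) ×
         (∀ j → j ∈ J → Finite (ν (swap J j e)) → ¬ (val (ν (swap J j e)) + u e ≤ᴿ val (ν J) + u j)))
      separating-weight = u ,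
        (λ j j∉I f → ≤.trans (≤.reflexive (+-ue _)) (proj₁ (proj₂ (proj₂ (pick j))) j∉I f)) ,
        (λ j j∈J f le → proj₂ (proj₂ (proj₂ (pick j))) j∈J f (≤.trans (≤.reflexive (≈.sym (+-ue _))) le))
        where
        u : Fin n → R
        u k = proj₁ (pick k)
        +-ue : ∀ x → x + u e ≈ x
        +-ue x = ≈.trans (≈.+-cong ≈.refl (≈.reflexive (proj₁ (proj₂ (pick e)) refl))) (≈.+-identityʳ x)

    -- Local optimality of I at e suffices, by exchange with an arbitrary minimiser.
    minBase-through : ∀ u {μ r} → ValuatedQuotient {n} μ r μ r → ∀ {I e} → Bases μ r I → e ∈ I →
      (∀ j → j ∉ I → Finite (μ (swap I e j)) → val (μ I) + u e ≤ᴿ val (μ (swap I e j)) + u j) →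
      ∃[ B ] (MinBase u μ r B × e ∈ B)
    minBase-through u {μ} vq {I} {e} bI e∈I local with minBase-exists u (I , bI)
    ... | B , bB , minB with e ∈? B
    ...   | yes e∈B = B , (bB , minB) , e∈B
    ...   | no e∉B with exchange vq bI bB e∈I e∉B
    ...     | j , j∈B , j∉I , bI₁ , bB₁ , le = swap B j e ,
              (bB₁ , λ C bC → ≤.trans (+-≤-splitʳ (cost-swap u μ μ e∈I e∉B j∈B j∉I le)
                (cost-≤-swap u μ e∈I j∉I (local j j∉I (proj₂ bI₁)))) (minB C bC)) ,
              ∈-swap-new B j e

    -- If a minimiser `B` contained `e`, exchange with `J` would give a swap of `B` that is no
    -- cheaper, hence a swap of `J` that is no dearer, against strictness.
    minBase-avoids : ∀ u {ν s} → ValuatedQuotient {n} ν s ν s → ∀ {J e} → Bases ν s J → e ∉ J →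
      (∀ j → j ∈ J → Finite (ν (swap J j e)) → ¬ (val (ν (swap J j e)) + u e ≤ᴿ val (ν J) + u j)) →
      ∀ {B} → MinBase u ν s B → e ∉ B
    minBase-avoids u {ν} vq bJ e∉J strict (bB , minB) e∈B with exchange vq bB bJ e∈B e∉J
    ... | j , j∈J , j∉B , bB₁ , bJ₁ , le = strict j j∈J (proj₂ bJ₁) (cost-swap-≤ u ν j∈J e∉J
            (+-≤-splitʳ (cost-swap u ν ν e∈B e∉J j∈J j∉B le) (minB _ bB₁)))

    -- An element in no basis of `𝓒` is a circuit by itself, so the quotient places a circuit of `𝓑`
    -- inside `⁅ e ⁆`; but `⁅ e ⁆` lies in the basis `B`.
    loop-transfer : ∀ {𝓑 𝓒 : Subset n → Set} → ∃ 𝓒 → MatroidQuotient 𝓑 𝓒 → ∀ {e B} → 𝓑 B → e ∈ B →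
      ¬ (∀ {C} → 𝓒 C → e ∉ C)
    loop-transfer (C₀ , cC₀) quot {e} {B} bB e∈B loop
      with quot ⁅ e ⁆ ((λ (C , cC , e⊆C) → loop cC (e⊆C (x∈⁅x⁆ e))) ,
             λ { X (X⊆e , x , x∈e , x∉X) → C₀ , cC₀ , λ k∈X → contradiction
               (subst (_∈ X) (trans (x∈⁅y⁆⇒x≡y e (X⊆e k∈X)) (sym (x∈⁅y⁆⇒x≡y e x∈e))) k∈X) x∉X })
             e (x∈⁅x⁆ e)
    ... | D , (depD , _) , D⊆e , _ = depD (B , bB , λ k∈D → subst (_∈ B) (sym (x∈⁅y⁆⇒x≡y e (D⊆e k∈D))) e∈B)

  -- Exchange and induced subdivisions.

  module _ {n k : ℕ} (r : Fin k → ℕ) (μ : Fin k → Subset n → 𝕋)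
           (valuated : ∀ i → IsValuatedMatroid (μ i) (r i)) where

    B⇒C : CondB r μ → CondC r μ
    B⇒C condB u = (λ i → MinBase u (μ i) (r i)) , ((λ i → nonempty i , basis-exchange i) , quotient) ,
      λ B → mk⇔ (isMinimizer⇒minBases r μ u) (minBases⇒isMinimizer r μ u)
      where
      nonempty : ∀ i → ∃ (MinBase u (μ i) (r i))
      nonempty i = minBase-exists u (proj₁ (proj₁ (valuated i)))
      basis-exchange : ∀ i B B′ → MinBase u (μ i) (r i) B → MinBase u (μ i) (r i) B′ → ∀ x → x ∈ B → x ∉ B′ →
        ∃[ y ] (y ∈ B′ × y ∉ B × MinBase u (μ i) (r i) (swap B x y))
      basis-exchange i B B′ mB mB′ x x∈B x∉B′
        with minBase-exchange u (proj₂ (valuated i)) mB mB′ x∈B x∉B′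
      ... | y , y∈B′ , y∉B , mB₁ , _ = y , y∈B′ , y∉B , mB₁
      quotient : ∀ i j → i Fin.< j → MatroidQuotient (MinBase u (μ i) (r i)) (MinBase u (μ j) (r j))
      quotient i j i<j = exchange⇒matroidQuotient (minBase? u (μ i) (r i)) (nonempty i)
        (minBase-exchange u (condB i j i<j))

    C⇒B : CondC r μ → CondB r μ
    C⇒B condC a b a<b I J bI bJ e e∈I e∉J
      -- By decidability of the order, either a partner is found or every candidate fails, as the
      -- separating weight requires.
      with any? (λ j → (j ∈? J) ×-dec ¬? (j ∈? I) ×-dec
             ((μ a (swap I e j) ⊙ μ b (swap J j e)) ≤T? (μ a I ⊙ μ b J)))
    ... | yes found = found
    ... | no none with separating-weight {μ = μ a} {ν = μ b} (proj₂ bI) (proj₂ bJ) e∈I e∉J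
                         (λ j j∈J j∉I le → none (j , j∈J , j∉I , le))
    ...   | u , local , strict with condC u
    ...     | 𝓝 , (matroids , quotients) , minimizers
      with minBase-through u (proj₂ (valuated a)) bI e∈I local
    ...       | B , mB , e∈B =
      ⊥-elim (loop-transfer (T b , 𝓝T b) (quotients a b a<b) (minBase⇒𝓝 mB) e∈B
        (λ 𝓝C → minBase-avoids u (proj₂ (valuated b)) bJ e∉J strict (𝓝⇒minBase 𝓝C)))
      where
      -- Minimisers are tuples, so a single basis is completed by fixed bases `T` in the other
      -- components.
      T : Fin k → Subset n
      T c = proj₁ (proj₁ (matroids c))
      𝓝T : ∀ c → 𝓝 c (T c)
      𝓝T c = proj₂ (proj₁ (matroids c))
      𝓝⇒minBase : ∀ {c B} → 𝓝 c B → MinBase u (μ c) (r c) B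
      𝓝⇒minBase {c} 𝓝B = subst (MinBase u (μ c) (r c)) (updateAt-updates c T)
        (isMinimizer⇒minBases r μ u (Equivalence.from (minimizers _) (updateAt-all {P = 𝓝} 𝓝T 𝓝B)) c)
      minBase⇒𝓝 : ∀ {c B} → MinBase u (μ c) (r c) B → 𝓝 c B
      minBase⇒𝓝 {c} mB = subst (𝓝 c) (updateAt-updates c T)
        (Equivalence.to (minimizers _) (minBases⇒isMinimizer r μ u
          (updateAt-all {P = λ i → MinBase u (μ i) (r i)} (𝓝⇒minBase ∘ 𝓝T) mB)) c)

  -- Projective tropical linear spaces

  -- Here `U` and `V` are the linear parts, for the weight `- x`, of a set and its swap; `y` and `z`
  -- are the coordinates of `x` at the removed and the inserted element.
  tilt : ∀ {s b U V y z} → s + y ≤ᴿ b + z → V + - y ≈ U + - z → s + V ≤ᴿ b + U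
  tilt {y = y} {z} le eq = by-adding
    (+-mono₂-≤ le (+-mono₂-≤ (≤.reflexive eq)
      (+-mono₂-≤ (≤.reflexive (≈.sym (≈.-‿inverseʳ y))) (≤.reflexive (≈.-‿inverseʳ z)))))
    (solve 8 (λ s b U V y y′ z z′ →
        (s ⊕ V) ⊕ ((b ⊕ z) ⊕ ((U ⊕ z′) ⊕ ((y ⊕ y′) ⊕ ∅)))
      ⊜ (b ⊕ U) ⊕ ((s ⊕ y) ⊕ ((V ⊕ y′) ⊕ (∅ ⊕ (z ⊕ z′)))))
      ≈.refl _ _ _ _ _ _ _ _)

  -- The passage back, from the contraction to `μ`: `p` is the value of the restriction, common to
  -- both sets.
  untilt : ∀ {b s U V y z m m₁ p} → b + U ≤ᴿ s + V → V + - z ≈ U + - y → m ≈ p + b → m₁ ≈ p + s →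
    m + y ≤ᴿ m₁ + z
  untilt {y = y} {z} le eq m≈ m₁≈ = by-adding
    (+-mono₂-≤ le (+-mono₂-≤ (≤.reflexive eq)
      (+-mono₂-≤ (≤.reflexive (≈.-‿inverseʳ y)) (+-mono₂-≤ (≤.reflexive (≈.sym (≈.-‿inverseʳ z)))
        (+-mono₂-≤ (≤.reflexive m≈) (≤.reflexive (≈.sym m₁≈)))))))
    (solve 11 (λ b s U V y y′ z z′ m m₁ p →
        (m ⊕ y) ⊕ ((s ⊕ V) ⊕ ((U ⊕ y′) ⊕ (∅ ⊕ ((z ⊕ z′) ⊕ ((p ⊕ b) ⊕ m₁)))))
      ⊜ (m₁ ⊕ z) ⊕ ((b ⊕ U) ⊕ ((V ⊕ z′) ⊕ ((y ⊕ y′) ⊕ (∅ ⊕ (m ⊕ (p ⊕ s)))))))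
      ≈.refl _ _ _ _ _ _ _ _ _ _ _)

  module _ {n : ℕ} where

    ∈infSet⇒∞ : ∀ (x : Fin n → 𝕋) {i} → i ∈ infSet x → x i ≡ ∞
    ∈infSet⇒∞ x {i} i∈ with x i | trans (sym (lookup∘tabulate (isInf ∘ x) i)) ([]=⇒lookup i∈)
    ... | ∞ | _ = refl

    finite⇒∉infSet : ∀ (x : Fin n → 𝕋) {i} → Finite (x i) → i ∉ infSet x
    finite⇒∉infSet x fx i∈ = fx (∈infSet⇒∞ x i∈)

    ∉infSet⇒finite : ∀ (x : Fin n → 𝕋) {i} → i ∉ infSet x → Finite (x i)
    ∉infSet⇒finite x {i} i∉ xi≡∞ = i∉ (lookup⇒[]= i (infSet x)
      (trans (lookup∘tabulate (isInf ∘ x) i) (cong isInf xi≡∞)))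

    -- The description of the projective tropical linear space by valuated circuits on the whole
    -- ground set: infinite coordinates are allowed and no contraction occurs.
    Orthogonal : (Subset n → 𝕋) → ℕ → (Fin n → 𝕋) → Set
    Orthogonal ν s x = ∀ J′ → ∣ J′ ∣ ≡ suc s → Balanced (_∈ J′) (λ j → ν (J′ - j) ⊙ x j)

    module _ {Z : Subset n} where

      swap-─-∈ : ∀ {P : Subset n} {i j} → i ∈ Z → j ∈ Z → swap P i j ─ Z ≡ P ─ Z
      swap-─-∈ {P} {i} {j} i∈Z j∈Z = ⊆-antisym to from
        where
        to : swap P i j ─ Z ⊆ P ─ Z
        to k∈ with ∈-─⁻ (swap P i j) Z k∈
        ... | k∈S , k∉Z = [ (λ (k∈P , _) → x∈p∧x∉q⇒x∈p─q k∈P k∉Z) , (λ { refl → contradiction j∈Z k∉Z }) ]′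
                            (∈-swap⁻ P k∈S)
        from : P ─ Z ⊆ swap P i j ─ Z
        from k∈ with ∈-─⁻ P Z k∈
        ... | k∈P , k∉Z = x∈p∧x∉q⇒x∈p─q (∈-swap-old j k∈P (∈∧∉⇒≢ i∈Z k∉Z ∘ sym)) k∉Z

      swap-─-∉ : ∀ {P : Subset n} {i j} → j ∉ Z → swap P i j ─ Z ≡ swap (P ─ Z) i j
      swap-─-∉ {P} {i} {j} j∉Z = ⊆-antisym to from
        where
        to : swap P i j ─ Z ⊆ swap (P ─ Z) i j
        to k∈ with ∈-─⁻ (swap P i j) Z k∈
        ... | k∈S , k∉Z = [ (λ (k∈P , k≢i) → ∈-swap-old j (x∈p∧x∉q⇒x∈p─q k∈P k∉Z) k≢i)
                          , (λ { refl → ∈-swap-new (P ─ Z) i j }) ]′ (∈-swap⁻ P k∈S)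
        from : swap (P ─ Z) i j ⊆ swap P i j ─ Z
        from k∈ with ∈-swap⁻ (P ─ Z) k∈
        ... | inj₂ refl = x∈p∧x∉q⇒x∈p─q (∈-swap-new P i j) j∉Z
        ... | inj₁ (k∈P─Z , k≢i) with ∈-─⁻ P Z k∈P─Z
        ...   | k∈P , k∉Z = x∈p∧x∉q⇒x∈p─q (∈-swap-old j k∈P k≢i) k∉Z

      swap-∩-∈ : ∀ {P : Subset n} {i j} → j ∈ Z → swap P i j ∩ Z ≡ swap (P ∩ Z) i j
      swap-∩-∈ {P} {i} {j} j∈Z = ⊆-antisym to from
        where
        to : swap P i j ∩ Z ⊆ swap (P ∩ Z) i j
        to k∈ with x∈p∩q⁻ (swap P i j) Z k∈
        ... | k∈S , k∈Z = [ (λ (k∈P , k≢i) → ∈-swap-old j (x∈p∩q⁺ (k∈P , k∈Z)) k≢i)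
                          , (λ { refl → ∈-swap-new (P ∩ Z) i j }) ]′ (∈-swap⁻ P k∈S)
        from : swap (P ∩ Z) i j ⊆ swap P i j ∩ Z
        from k∈ with ∈-swap⁻ (P ∩ Z) k∈
        ... | inj₂ refl = x∈p∩q⁺ (∈-swap-new P i j , j∈Z)
        ... | inj₁ (k∈P∩Z , k≢i) with x∈p∩q⁻ P Z k∈P∩Z
        ...   | k∈P , k∈Z = x∈p∩q⁺ (∈-swap-old j k∈P k≢i , k∈Z)

      swap-∩-∉ : ∀ {P : Subset n} {i j} → i ∉ Z → j ∉ Z → swap P i j ∩ Z ≡ P ∩ Z
      swap-∩-∉ {P} {i} {j} i∉Z j∉Z = ⊆-antisym to from
        where
        to : swap P i j ∩ Z ⊆ P ∩ Z
        to k∈ with x∈p∩q⁻ (swap P i j) Z k∈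
        ... | k∈S , k∈Z = [ (λ (k∈P , _) → x∈p∩q⁺ (k∈P , k∈Z)) , (λ { refl → contradiction k∈Z j∉Z }) ]′
                            (∈-swap⁻ P k∈S)
        from : P ∩ Z ⊆ swap P i j ∩ Z
        from k∈ with x∈p∩q⁻ P Z k∈
        ... | k∈P , k∈Z = x∈p∩q⁺ (∈-swap-old j k∈P (∈∧∉⇒≢ k∈Z i∉Z) , k∈Z)

      ∣swap-∩∣ : ∀ {P : Subset n} {i j} → i ∈ P → i ∈ Z → j ∈ Z → j ∉ P → ∣ swap P i j ∩ Z ∣ ≡ ∣ P ∩ Z ∣
      ∣swap-∩∣ {P} {i} {j} i∈P i∈Z j∈Z j∉P = trans (cong ∣_∣ (swap-∩-∈ {P} {i} j∈Z))
        (∣swap∣ {B = P ∩ Z} {i} {j} (x∈p∩q⁺ (i∈P , i∈Z)) (j∉P ∘ proj₁ ∘ x∈p∩q⁻ P Z))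

      swap-mix : ∀ (P Q : Subset n) {i j} → i ∈ Z → j ∈ Z → swap (mix Z P Q) i j ≡ mix Z (swap P i j) Q
      swap-mix P Q {i} {j} i∈Z j∈Z = ∩∧─⇒≡
        (trans (swap-∩-∈ j∈Z) (trans (cong (λ A → swap A i j) (mix-∩ Z P Q))
          (trans (sym (swap-∩-∈ j∈Z)) (sym (mix-∩ Z (swap P i j) Q)))))
        (trans (swap-─-∈ i∈Z j∈Z) (trans (mix-─ Z P Q) (sym (mix-─ Z (swap P i j) Q))))

      ∣mix∣ : ∀ (P Q : Subset n) → ∣ mix Z P Q ∣ ≡ ∣ P ∩ Z ∣ ℕ.+ ∣ Q ─ Z ∣
      ∣mix∣ P Q = trans (sym (∣∩∣+∣─∣ (mix Z P Q) Z))
        (cong₂ (λ A B → ∣ A ∣ ℕ.+ ∣ B ∣) (mix-∩ Z P Q) (mix-─ Z P Q))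

    -- Bases meeting a set maximally.

    module _ {μ : Subset n → 𝕋} {r : ℕ} {Z : Subset n} where

      basesMaxMeet? : Decidable (BasesMaxMeet μ r Z)
      basesMaxMeet? B = bases? μ r B ×-dec
        allSubset? λ B′ → implies? (bases? μ r B′) (∣ B′ ∩ Z ∣ ℕₚ.≤? ∣ B ∩ Z ∣)

      basesMaxMeet-exists : ∃ (Bases μ r) → ∃ (BasesMaxMeet μ r Z)
      basesMaxMeet-exists =
        argmin {_≼_ = ℕ._≥_} (λ a b → ℕₚ.≤-total b a) (λ p q → ℕₚ.≤-trans q p) (λ B → ∣ B ∩ Z ∣) (bases? μ r)

      basesMaxMeet-transport : ∀ {B B′} → BasesMaxMeet μ r Z B → Bases μ r B′ →
        ∣ B′ ∩ Z ∣ ≡ ∣ B ∩ Z ∣ → BasesMaxMeet μ r Z B′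
      basesMaxMeet-transport (_ , max) bB′ eq =
        bB′ , λ C bC → ℕₚ.≤-trans (max C bC) (ℕₚ.≤-reflexive (sym eq))

      -- If `j` lay outside `Z`, the swap would meet `Z` in strictly more elements than `A`.
      swap-in⇒out : ∀ {A i j} → BasesMaxMeet μ r Z A → Bases μ r (swap A j i) → i ∈ Z → i ∉ A → j ∈ Z
      swap-in⇒out {A} {i} {j} (_ , max) bS i∈Z i∉A = decidable-stable (j ∈? Z) λ j∉Z →
        ℕₚ.<⇒≱ (p⊂q⇒∣p∣<∣q∣ ((λ k∈ → grow j∉Z (x∈p∩q⁻ A Z k∈)) ,
                 i , x∈p∩q⁺ (∈-swap-new A j i , i∈Z) , i∉A ∘ proj₁ ∘ x∈p∩q⁻ A Z))
               (max (swap A j i) bS)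
        where
        grow : ∀ {k} → j ∉ Z → k ∈ A × k ∈ Z → k ∈ swap A j i ∩ Z
        grow j∉Z (k∈A , k∈Z) = x∈p∩q⁺ (∈-swap-old i k∈A (∈∧∉⇒≢ k∈Z j∉Z) , k∈Z)

    -- I is a minimiser of the contraction tilted by -x.
    projTrop⇒optimal : ∀ {μ r x} → ∃ (Bases μ r) → InProjTrop μ r x → ∀ e → Finite (x e) →
      ∃[ I ] (BasesMaxMeet μ r (infSet x) I × e ∈ I ×
        (∀ j → j ∉ I → j ∉ infSet x → Bases μ r (swap I e j) →
           val (μ I) + val (x j) ≤ᴿ val (μ (swap I e j)) + val (x e)))
    projTrop⇒optimal {μ} {r} {x} ne (_ , ν , r′ , (rank , ν-finite , ρ , split) , trop) e fe = result (e ∈? proj₁ optimum)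
      where
      Z : Subset n
      Z = infSet x
      e∉Z : e ∉ Z
      e∉Z = finite⇒∉infSet x fe
      u : Fin n → R
      u k = - val (x k)
      obj : Subset n → R
      obj B = cost u ν (B ─ Z)
      split-val : ∀ {B} → BasesMaxMeet μ r Z B →
        Finite (ν (B ─ Z)) × (val (μ B) ≈ val (ρ (B ∩ Z)) + val (ν (B ─ Z)))
      split-val {B} mB with ⊙-finite⁻ (≈T-finite (split B mB) (proj₂ (proj₁ mB)))
      ... | fρ , fν = fν , ≈.trans (≈T-val (split B mB)) (≈.reflexive (val-⊙ fρ fν))
      -- The swap takes place outside `Z`, so both bases share the restriction term `ρ (I ∩ Z)`, and
      -- the comparison for `ν` lifts to `μ`.
      local : ∀ {I} → BasesMaxMeet μ r Z I → (∀ B → BasesMaxMeet μ r Z B → obj I ≤ᴿ obj B) → e ∈ I →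
        ∀ j → j ∉ I → j ∉ Z → Bases μ r (swap I e j) →
        val (μ I) + val (x j) ≤ᴿ val (μ (swap I e j)) + val (x e)
      local {I} mI minI e∈I j j∉I j∉Z bI₁ = untilt
        (subst (λ A → obj I ≤ᴿ cost u ν A) I₁─Z (minI (swap I e j) mI₁))
        (sum-swap u (x∈p∧x∉q⇒x∈p─q e∈I e∉Z) (j∉I ∘ p─q⊆p I Z))
        (proj₂ (split-val mI))
        (subst₂ (λ A C → val (μ (swap I e j)) ≈ val (ρ A) + val (ν C)) I₁∩Z I₁─Z (proj₂ (split-val mI₁)))
        where
        I₁∩Z : swap I e j ∩ Z ≡ I ∩ Z
        I₁∩Z = swap-∩-∉ e∉Z j∉Z
        I₁─Z : swap I e j ─ Z ≡ swap (I ─ Z) e j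
        I₁─Z = swap-─-∉ j∉Z
        mI₁ : BasesMaxMeet μ r Z (swap I e j)
        mI₁ = basesMaxMeet-transport mI bI₁ (cong ∣_∣ I₁∩Z)
      -- If the optimum misses `e`, the circuit on `(I ─ Z) ∪ ⁅ e ⁆` has a further entry `j` no
      -- larger than the one at `e`, and replacing `j` by `e` does not raise the objective.
      module _ {I : Subset n} (mI : BasesMaxMeet μ r Z I) (e∉I : e ∉ I) where
        S′ : Subset n
        S′ = (I ─ Z) ∪ ⁅ e ⁆
        e∉ : e ∉ I ─ Z
        e∉ = e∉I ∘ p─q⊆p I Z
        S′⊆∁Z : S′ ⊆ ∁ Z
        S′⊆∁Z k∈ = x∉p⇒x∈∁p
          ([ (λ k∈I─Z → proj₂ (∈-─⁻ I Z k∈I─Z)) , (λ { refl → e∉Z }) ]′ (∈-∪⁅⁆⁻ (I ─ Z) k∈))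
        fν : Finite (ν (S′ - e))
        fν = subst (Finite ∘ ν) (sym (delete-insert e∉)) (proj₁ (split-val mI))
        second : ∃[ j ] (j ≢ e × (j ∈ S′ × Finite (ν (S′ - j))) × ν (S′ - j) ⊙ x j ≤T ν (S′ - e) ⊙ x e)
        second = minTwice⇒balanced _≟_
          (trop S′ S′⊆∁Z (trans (∣insert∣ (I ─ Z) e e∉) (cong suc (rank I mI))))
          e (∈-∪⁅⁆ʳ (I ─ Z) e , fν) (⊙-finite fν fe)
        j : Fin n
        j = proj₁ second
        j≢e : j ≢ e
        j≢e = proj₁ (proj₂ second)
        j∈ : j ∈ I ─ Z
        j∈ = [ id , (λ j≡e → contradiction j≡e j≢e) ]′ (∈-∪⁅⁆⁻ (I ─ Z) (proj₁ (proj₁ (proj₂ (proj₂ second)))))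
        J≡S′-j : swap (I ─ Z) j e ≡ S′ - j
        J≡S′-j = delete-insert-comm (I ─ Z) j≢e
        val-le : val (ν (swap (I ─ Z) j e)) + val (x j) ≤ᴿ val (ν (I ─ Z)) + val (x e)
        val-le = proj₂ (proj₂ (⊙-≤T⁻ (proj₁ (split-val mI)) fe
          (subst₂ (λ A C → ν A ⊙ x j ≤T ν C ⊙ x e)
            (sym J≡S′-j) (delete-insert e∉) (proj₂ (proj₂ (proj₂ second))))))
        -- The part of the lift inside `Z` is not controlled, but the objective depends only on the
        -- part outside.
        lifted : ∃[ B ] (BasesMaxMeet μ r Z B × B ─ Z ≡ swap (I ─ Z) j e)
        lifted = ν-finite (swap (I ─ Z) j e)
          (λ k∈ → S′⊆∁Z (p─q⊆p S′ ⁅ j ⁆ (subst (_ ∈_) J≡S′-j k∈)))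
          (trans (∣swap∣ j∈ e∉) (rank I mI))
          (subst (Finite ∘ ν) (sym J≡S′-j) (proj₂ (proj₁ (proj₂ (proj₂ second)))))
        through : ∃[ B ] (BasesMaxMeet μ r Z B × e ∈ B × obj B ≤ᴿ obj I)
        through = let B , mB , B─Z≡J = lifted in B , mB ,
          proj₁ (∈-─⁻ B Z (subst (e ∈_) (sym B─Z≡J) (∈-swap-new (I ─ Z) j e))) ,
          subst (λ A → cost u ν A ≤ᴿ obj I) (sym B─Z≡J) (tilt val-le (sum-swap u j∈ e∉))
      optimum : ∃[ I ] (BasesMaxMeet μ r Z I × (∀ B → BasesMaxMeet μ r Z B → obj I ≤ᴿ obj B))
      optimum = argmin ≤.total ≤.trans obj basesMaxMeet? (basesMaxMeet-exists ne)
      result : Dec (e ∈ proj₁ optimum) → ∃[ I ] (BasesMaxMeet μ r Z I × e ∈ I ×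
        (∀ j → j ∉ I → j ∉ Z → Bases μ r (swap I e j) →
           val (μ I) + val (x j) ≤ᴿ val (μ (swap I e j)) + val (x e)))
      result (yes e∈I) = let I , mI , minI = optimum in I , mI , e∈I , local mI minI e∈I
      result (no e∉I) =
        let I , mI , minI = optimum
            B , mB , e∈B , le = through mI e∉I
        in B , mB , e∈B , local mB (λ C mC → ≤.trans le (minI C mC)) e∈B

    -- An optimal basis `I` through `e` is exchanged with `J′ - e`; adding local optimality of `I`
    -- eliminates `μ` from the inequality. The partner has a finite coordinate, since `I` meets
    -- `infSet x` maximally and `e` lies outside it.
    projTrop⇒orthogonal : ∀ {μ r ν s x} → ValuatedQuotient μ r ν s → ∃ (Bases μ r) →
      InProjTrop μ r x → Orthogonal ν s x
    projTrop⇒orthogonal {μ} {r} {ν} {s} {x} vq ne tropx J′ ∣J′∣ e e∈J′ fe with ⊙-finite⁻ {ν (J′ - e)} fe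
    ... | fν , fx with projTrop⇒optimal ne tropx e fx
    ...   | I , mI , e∈I , local
      with exchange vq (proj₁ mI) (ℕₚ.suc-injective (trans (∣delete∣ e∈J′) ∣J′∣) , fν) e∈I (∉- J′)
    ...     | j , j∈J , j∉I , bI₁ , bJ₁ , le = j , j≢e , proj₁ (∈--⁻ J′ j∈J) ,
      subst (λ A → ν A ⊙ x j ≤T ν (J′ - e) ⊙ x e) (swap-delete e∈J′ j≢e)
        (⊙-≤T⁺ (proj₂ bJ₁) (∉infSet⇒finite x j∉Z) fν fx (by-adding
          (+-mono₂-≤ le (local j j∉I j∉Z bI₁))
          (solve 6 (λ m₀ m₁ n₀ n₁ a b → (n₁ ⊕ b) ⊕ ((m₀ ⊕ n₀) ⊕ (m₁ ⊕ a)) ⊜ (n₀ ⊕ a) ⊕ ((m₁ ⊕ n₁) ⊕ (m₀ ⊕ b)))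
            ≈.refl _ _ _ _ _ _)))
      where
      j≢e : j ≢ e
      j≢e = proj₂ (∈--⁻ J′ j∈J)
      j∉Z : j ∉ infSet x
      j∉Z j∈Z = finite⇒∉infSet x fx (swap-in⇒out mI bI₁ j∈Z j∉I)

    -- Decomposition into restriction and contraction.

    module _ {μ : Subset n → 𝕋} {r : ℕ} (vq : ValuatedQuotient μ r μ r) {Z : Subset n} where

      private
        -- Additivity over `Z` and its complement, phrased without naming the two summands:
        -- interchanging the parts inside `Z` preserves the total value.
        Splits : Subset n → Subset n → Set
        Splits B B₀ = Bases μ r (mix Z B B₀) × Bases μ r (mix Z B₀ B) ×
          (val (μ B) + val (μ B₀) ≈ val (μ (mix Z B B₀)) + val (μ (mix Z B₀ B)))

      -- When the parts inside `Z` coincide, mixing merely permutes the two bases.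
      split-equal : ∀ {B B₀} → Bases μ r B → Bases μ r B₀ → B ∩ Z ≡ B₀ ∩ Z → Splits B B₀
      split-equal {B} {B₀} bB bB₀ eq = subst₂ (λ A C → Bases μ r A × Bases μ r C ×
          (val (μ B) + val (μ B₀) ≈ val (μ A) + val (μ C)))
        (sym (trans (cong (_∪ (B₀ ─ Z)) eq) (mix-refl Z B₀)))
        (sym (trans (cong (_∪ (B ─ Z)) (sym eq)) (mix-refl Z B)))
        (bB₀ , bB , ≈.+-comm _ _)

      -- Exchanging inside Z in both directions between B (or B - i + j) and its
      -- mixture with B₀ leaves no choice for the exchanged elements, so that the
      -- two exchange inequalities are opposite to each other.
      split-step : ∀ {B B₀ i j} → BasesMaxMeet μ r Z B → Bases μ r (swap B i j) → i ∈ Z → j ∈ Z →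
        i ∈ B → j ∉ B → Splits (swap B i j) B₀ → Splits B B₀
      split-step {B} {B₀} {i} {j} mB bB₁ i∈Z j∈Z i∈B j∉B (bA₁ , bC₁ , eq₁) =
        bA , subst (Bases μ r) C₁≡C bC₁ , ≤.antisym
          (by-adding (+-mono₂-≤ backward (≤.reflexive eq))
            (solve 6 (λ b b₀ b₁ a a₁ c → (b ⊕ b₀) ⊕ ((b₁ ⊕ a) ⊕ (a₁ ⊕ c)) ⊜ (a ⊕ c) ⊕ ((b ⊕ a₁) ⊕ (b₁ ⊕ b₀)))
              ≈.refl _ _ _ _ _ _))
          (by-adding (+-mono₂-≤ forward (≤.reflexive (≈.sym eq)))
            (solve 6 (λ b b₀ b₁ a a₁ c → (a ⊕ c) ⊕ ((b ⊕ a₁) ⊕ (b₁ ⊕ b₀)) ⊜ (b ⊕ b₀) ⊕ ((b₁ ⊕ a) ⊕ (a₁ ⊕ c)))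
              ≈.refl _ _ _ _ _ _))
        where
        B₁ A A₁ : Subset n
        B₁ = swap B i j
        A = mix Z B B₀
        A₁ = mix Z B₁ B₀
        C₁≡C : mix Z B₀ B₁ ≡ mix Z B₀ B
        C₁≡C = cong ((B₀ ∩ Z) ∪_) (swap-─-∈ i∈Z j∈Z)
        eq : val (μ B₁) + val (μ B₀) ≈ val (μ A₁) + val (μ (mix Z B₀ B))
        eq = subst (λ C → val (μ B₁) + val (μ B₀) ≈ val (μ A₁) + val (μ C)) C₁≡C eq₁
        i≢j : i ≢ j
        i≢j = ∈∧∉⇒≢ i∈B j∉B
        ∣B₁∩Z∣ : ∣ B₁ ∩ Z ∣ ≡ ∣ B ∩ Z ∣
        ∣B₁∩Z∣ = ∣swap-∩∣ i∈B i∈Z j∈Z j∉B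
        mA₁ : BasesMaxMeet μ r Z A₁
        mA₁ = basesMaxMeet-transport mB bA₁ (trans (cong ∣_∣ (mix-∩ Z B₁ B₀)) ∣B₁∩Z∣)
        i∉A₁ : i ∉ A₁
        i∉A₁ i∈A₁ = ∉-swap B i≢j (∈-mix⁻-∈ B₁ B₀ i∈A₁ i∈Z)
        A≡ : swap A₁ j i ≡ A
        A≡ = trans (swap-mix B₁ B₀ j∈Z i∈Z) (cong (λ C → mix Z C B₀) (swap-swap i∈B j∉B))
        A₁≡ : swap A i j ≡ A₁
        A₁≡ = swap-mix B B₀ i∈Z j∈Z
        first : ∃[ k ] (k ∈ A₁ × k ∉ B × Bases μ r (swap B i k) × Bases μ r (swap A₁ k i) ×
                        val (μ (swap B i k)) + val (μ (swap A₁ k i)) ≤ᴿ val (μ B) + val (μ A₁))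
        first = exchange vq (proj₁ mB) bA₁ i∈B i∉A₁
        -- As `i` enters from `Z`, the leaving `k` lies in `Z`, where `A₁` agrees with `B₁`; outside
        -- `B` this leaves only `j`.
        forced : ∀ {k} → k ∈ A₁ → k ∉ B → Bases μ r (swap A₁ k i) → k ≡ j
        forced k∈A₁ k∉B b = [ (λ (k∈B , _) → contradiction k∈B k∉B) , id ]′
          (∈-swap⁻ B (∈-mix⁻-∈ B₁ B₀ k∈A₁ (swap-in⇒out mA₁ b i∈Z i∉A₁)))
        forward′ : Bases μ r A × val (μ B₁) + val (μ A) ≤ᴿ val (μ B) + val (μ A₁)
        forward′ =
          let k , k∈A₁ , k∉B , _ , b , le = first
              k≡j = forced k∈A₁ k∉B b
              swap≡A = trans (cong (λ h → swap A₁ h i) k≡j) A≡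
          in subst (Bases μ r) swap≡A b ,
             subst₂ (λ h D → val (μ (swap B i h)) + val (μ D) ≤ᴿ val (μ B) + val (μ A₁)) k≡j swap≡A le
        bA : Bases μ r A
        bA = proj₁ forward′
        forward : val (μ B₁) + val (μ A) ≤ᴿ val (μ B) + val (μ A₁)
        forward = proj₂ forward′
        mA : BasesMaxMeet μ r Z A
        mA = basesMaxMeet-transport mB bA (cong ∣_∣ (mix-∩ Z B B₀))
        j∉A : j ∉ A
        j∉A j∈A = j∉B (∈-mix⁻-∈ B B₀ j∈A j∈Z)
        second : ∃[ k ] (k ∈ A × k ∉ B₁ × Bases μ r (swap B₁ j k) × Bases μ r (swap A k j) ×
                         val (μ (swap B₁ j k)) + val (μ (swap A k j)) ≤ᴿ val (μ B₁) + val (μ A))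
        second = exchange vq bB₁ bA (∈-swap-new B i j) j∉A
        forced′ : ∀ {k} → k ∈ A → k ∉ B₁ → Bases μ r (swap A k j) → k ≡ i
        forced′ {k} k∈A k∉B₁ b = decidable-stable (k ≟ i) λ k≢i →
          k∉B₁ (∈-swap-old j (∈-mix⁻-∈ B B₀ k∈A (swap-in⇒out mA b j∈Z j∉A)) k≢i)
        backward : val (μ B) + val (μ A₁) ≤ᴿ val (μ B₁) + val (μ A)
        backward =
          let k , k∈A , k∉B₁ , _ , b , le = second
              k≡i = forced′ k∈A k∉B₁ b
          in subst₂ (λ C D → val (μ C) + val (μ D) ≤ᴿ val (μ B₁) + val (μ A))
               (trans (cong (swap B₁ j) k≡i) (swap-swap i∈B j∉B))
               (trans (cong (λ h → swap A h j) k≡i) A₁≡) le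

      -- Induction on the number of elements of `B ∩ Z` missing from `B₀`. Exchanging one of them
      -- with `B₀` stays inside `Z` and lowers this number; once none is left, maximality makes the
      -- two intersections equal.
      split-bounded : ∀ d {B B₀} → ∣ (B ∩ Z) ─ B₀ ∣ ℕ.< d →
        BasesMaxMeet μ r Z B → BasesMaxMeet μ r Z B₀ → Splits B B₀
      split-bounded (suc d) {B} {B₀} ∣d∣ mB mB₀ with any? (λ i → ((i ∈? B) ×-dec (i ∈? Z)) ×-dec ¬? (i ∈? B₀))
      ... | no none = split-equal (proj₁ mB) (proj₁ mB₀) (⊆∧∣∣≥⇒≡ B∩Z⊆ (proj₂ mB B₀ (proj₁ mB₀)))
        where
        B∩Z⊆ : B ∩ Z ⊆ B₀ ∩ Z
        B∩Z⊆ {k} k∈ = x∈p∩q⁺ (decidable-stable (k ∈? B₀) (λ k∉B₀ → none (k , x∈p∩q⁻ B Z k∈ , k∉B₀)) ,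
                              proj₂ (x∈p∩q⁻ B Z k∈))
      ... | yes (i , (i∈B , i∈Z) , i∉B₀) with exchange vq (proj₁ mB) (proj₁ mB₀) i∈B i∉B₀
      ...   | j , j∈B₀ , j∉B , bB₁ , bB₀′ , _ =
        split-step mB bB₁ i∈Z j∈Z i∈B j∉B (split-bounded d smaller mB₁ mB₀)
        where
        j∈Z : j ∈ Z
        j∈Z = swap-in⇒out mB₀ bB₀′ i∈Z i∉B₀
        mB₁ : BasesMaxMeet μ r Z (swap B i j)
        mB₁ = basesMaxMeet-transport mB bB₁ (∣swap-∩∣ i∈B i∈Z j∈Z j∉B)
        shrink : (swap B i j ∩ Z) ─ B₀ ⊆ (B ∩ Z) ─ B₀
        shrink k∈ with ∈-─⁻ (swap B i j ∩ Z) B₀ k∈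
        ... | k∈∩ , k∉B₀ with x∈p∩q⁻ (swap B i j) Z k∈∩
        ...   | k∈B₁ , k∈Z = x∈p∧x∉q⇒x∈p─q
                (x∈p∩q⁺ ([ proj₁ , (λ { refl → contradiction j∈B₀ k∉B₀ }) ]′ (∈-swap⁻ B k∈B₁) , k∈Z)) k∉B₀
        smaller : ∣ (swap B i j ∩ Z) ─ B₀ ∣ ℕ.< d
        smaller = ℕₚ.<-≤-trans (p⊂q⇒∣p∣<∣q∣ (shrink , i , x∈p∧x∉q⇒x∈p─q (x∈p∩q⁺ (i∈B , i∈Z)) i∉B₀ ,
            λ i∈ → ∉-swap B (∈∧∉⇒≢ i∈B j∉B)
              (proj₁ (x∈p∩q⁻ (swap B i j) Z (proj₁ (∈-─⁻ (swap B i j ∩ Z) B₀ i∈))))))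
          (ℕ.s≤s⁻¹ ∣d∣)

      splits : ∀ {B B₀} → BasesMaxMeet μ r Z B → BasesMaxMeet μ r Z B₀ → Splits B B₀
      splits = split-bounded _ (ℕₚ.n<1+n _)

      module _ {B₀ : Subset n} (mB₀ : BasesMaxMeet μ r Z B₀) where

        -- The contraction in a fixed normalisation: every set is completed by the same basis
        -- `B₀ ∩ Z` of the restriction.
        contract : Subset n → 𝕋
        contract J = μ (mix Z B₀ J)

        contract-isContraction : IsContraction μ r Z contract ∣ B₀ ─ Z ∣
        -- The restriction is obtained by completing with `B₀ ─ Z`; subtracting the value of `B₀`
        -- compensates for its presence in `splits`.
        contract-isContraction = rank , lift , (λ K → μ (mix Z K B₀) ⊙ fin (- val (μ B₀))) , split
          where
          rank : ∀ B → BasesMaxMeet μ r Z B → ∣ B ─ Z ∣ ≡ ∣ B₀ ─ Z ∣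
          rank B (bB , max) = ℕₚ.+-cancelˡ-≡ ∣ B ∩ Z ∣ _ _
            (trans (∣∩∣+∣─∣ B Z) (trans (proj₁ bB) (trans (sym (proj₁ (proj₁ mB₀)))
              (trans (sym (∣∩∣+∣─∣ B₀ Z)) (cong (ℕ._+ ∣ B₀ ─ Z ∣)
                (ℕₚ.≤-antisym (max B₀ (proj₁ mB₀)) (proj₂ mB₀ B bB)))))))
          lift : ∀ J → J ⊆ ∁ Z → ∣ J ∣ ≡ ∣ B₀ ─ Z ∣ → Finite (contract J) →
            ∃[ B ] (BasesMaxMeet μ r Z B × (B ─ Z) ≡ J)
          lift J J⊆∁Z ∣J∣ f = mix Z B₀ J ,
            basesMaxMeet-transport mB₀
              (trans (∣mix∣ B₀ J) (trans (cong (∣ B₀ ∩ Z ∣ ℕ.+_) (trans (cong ∣_∣ (∉-─ J⊆∁Z)) ∣J∣))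
                (trans (∣∩∣+∣─∣ B₀ Z) (proj₁ (proj₁ mB₀)))) , f)
              (cong ∣_∣ (mix-∩ Z B₀ J)) ,
            trans (mix-─ Z B₀ J) (∉-─ J⊆∁Z)
          split : ∀ B → BasesMaxMeet μ r Z B →
            μ B ≈T (μ (mix Z (B ∩ Z) B₀) ⊙ fin (- val (μ B₀))) ⊙ contract (B ─ Z)
          split B mB = subst₂ (λ A C → μ B ≈T (μ A ⊙ fin (- val (μ B₀))) ⊙ μ C)
            (sym (mix-∩ˡ B B₀)) (sym (mix-─ʳ B₀ B)) (decompose (splits mB mB₀))
            where
            decompose : Splits B B₀ → μ B ≈T (μ (mix Z B B₀) ⊙ fin (- val (μ B₀))) ⊙ μ (mix Z B₀ B)
            decompose (bA , bC , eq) = val-≈T (proj₂ (proj₁ mB)) (⊙-finite fA′ (proj₂ bC))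
              (≈.trans (≈.sym (+-cancelʳ _ (val (μ B₀))))
              (≈.trans (≈.+-cong eq ≈.refl)
              (≈.trans (solve 3 (λ a c z → (a ⊕ c) ⊕ z ⊜ (a ⊕ z) ⊕ c) ≈.refl _ _ _)
              (≈.reflexive (sym (trans (val-⊙ fA′ (proj₂ bC))
                (cong (_+ val (μ (mix Z B₀ B))) (val-⊙ (proj₂ bA) λ ()))))))))
              where
              fA′ : Finite (μ (mix Z B B₀) ⊙ fin (- val (μ B₀)))
              fA′ = ⊙-finite (proj₂ bA) λ ()

    -- The contraction's circuit on `S′` agrees outside `Z` with the circuit of `μ` on
    -- `mix Z B₀ S′`, and inside `Z` the coordinates of `x` are infinite, so the additional entries
    -- never compete.
    orthogonal⇒projTrop : ∀ {μ r x} → ValuatedQuotient μ r μ r → ∃ (Bases μ r) → IsProjPoint x →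
      Orthogonal μ r x → InProjTrop μ r x
    orthogonal⇒projTrop {μ} {r} {x} vq ne proj orth =
      proj , contract vq mB₀ , ∣ B₀ ─ Z ∣ , contract-isContraction vq mB₀ , trop
      where
      Z : Subset n
      Z = infSet x
      B₀ : Subset n
      B₀ = proj₁ (basesMaxMeet-exists {Z = Z} ne)
      mB₀ : BasesMaxMeet μ r Z B₀
      mB₀ = proj₂ (basesMaxMeet-exists ne)
      trop : InTrop (contract vq mB₀) ∣ B₀ ─ Z ∣ (∁ Z) x
      trop S′ S′⊆∁Z ∣S′∣ = balanced⇒minTwice (List.allFin n) ∈-allFin
        (λ j → (j ∈? S′) ×-dec finite? (contract vq mB₀ (S′ - j))) balanced
        where
        T : Subset n
        T = mix Z B₀ S′
        ∣T∣ : ∣ T ∣ ≡ suc r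
        ∣T∣ = trans (∣mix∣ B₀ S′) (trans (cong (∣ B₀ ∩ Z ∣ ℕ.+_) (trans (cong ∣_∣ (∉-─ S′⊆∁Z)) ∣S′∣))
          (trans (ℕₚ.+-suc _ _) (cong suc (trans (∣∩∣+∣─∣ B₀ Z) (proj₁ (proj₁ mB₀))))))
        T- : ∀ {j} → j ∉ Z → μ (T - j) ≡ contract vq mB₀ (S′ - j)
        T- j∉Z = cong μ (mix-delete B₀ S′ j∉Z)
        balanced : Balanced (λ j → j ∈ S′ × Finite (contract vq mB₀ (S′ - j)))
                            (λ j → contract vq mB₀ (S′ - j) ⊙ x j)
        balanced a (a∈S′ , _) fa with orth T ∣T∣ a (∈-mix⁺-∉ B₀ a∈S′ a∉Z) (subst (λ y → Finite (y ⊙ x a)) (sym (T- a∉Z)) fa)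
          where
          a∉Z : a ∉ Z
          a∉Z = x∈∁p⇒x∉p (S′⊆∁Z a∈S′)
        ... | b , b≢a , b∈T , le = b , b≢a , (∈-mix⁻-∉ B₀ S′ b∈T b∉Z , proj₁ (⊙-finite⁻ (≤T-finite le′ fa))) , le′
          where
          a∉Z : a ∉ Z
          a∉Z = x∈∁p⇒x∉p (S′⊆∁Z a∈S′)
          b∉Z : b ∉ Z
          b∉Z = finite⇒∉infSet x (proj₂ (⊙-finite⁻ {μ (T - b)} (≤T-finite le
            (subst (λ y → Finite (y ⊙ x a)) (sym (T- a∉Z)) fa))))
          le′ : contract vq mB₀ (S′ - b) ⊙ x b ≤T contract vq mB₀ (S′ - a) ⊙ x a
          le′ = subst₂ (λ y z → y ⊙ x b ≤T z ⊙ x a) (T- b∉Z) (T- a∉Z) le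

    -- The valuated cocircuit of a set one smaller than a basis. On `I′` the value `∞` is imposed,
    -- since there `I′ ∪ ⁅ j ⁆` is `I′` itself, whose value under `μ` carries no meaning.
    cocircuit : (Subset n → 𝕋) → Subset n → Fin n → 𝕋
    cocircuit μ I′ j with j ∈? I′
    ... | yes _ = ∞
    ... | no _ = μ (I′ ∪ ⁅ j ⁆)

    cocircuit-∉ : ∀ μ {I′ j} → j ∉ I′ → cocircuit μ I′ j ≡ μ (I′ ∪ ⁅ j ⁆)
    cocircuit-∉ μ {I′} {j} j∉I′ with j ∈? I′
    ... | yes j∈I′ = contradiction j∈I′ j∉I′
    ... | no _ = refl

    cocircuit-finite : ∀ μ {I′ j} → Finite (cocircuit μ I′ j) → j ∉ I′
    cocircuit-finite μ {I′} {j} f with j ∈? I′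
    ... | yes _ = contradiction refl f
    ... | no j∉I′ = j∉I′

    module _ {μ ν : Subset n → 𝕋} {I′ J′ : Subset n} where

      private
        Incidence Circuit′ : Set
        Incidence = Balanced (λ j → j ∈ J′ × j ∉ I′) (λ j → μ (I′ ∪ ⁅ j ⁆) ⊙ ν (J′ - j))
        Circuit′ = Balanced (_∈ J′) (λ j → ν (J′ - j) ⊙ cocircuit μ I′ j)

      -- The two relations have the same terms up to order of the factors; the additional indices in
      -- `I′` carry `∞`.
      incidence⇒cocircuit : Incidence → Circuit′
      incidence⇒cocircuit bal a a∈J′ fa with bal a (a∈J′ , a∉I′) (⊙-finite (subst Finite (cocircuit-∉ μ a∉I′) fx) fν)
        where
        fν = proj₁ (⊙-finite⁻ {ν (J′ - a)} fa)
        fx = proj₂ (⊙-finite⁻ {ν (J′ - a)} fa)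
        a∉I′ = cocircuit-finite μ fx
      ... | b , b≢a , (b∈J′ , b∉I′) , le = b , b≢a , b∈J′ ,
        subst₂ (λ y z → ν (J′ - b) ⊙ y ≤T ν (J′ - a) ⊙ z) (sym (cocircuit-∉ μ b∉I′)) (sym (cocircuit-∉ μ a∉I′))
          (⊙-≤T-comm (⊙-finite (subst Finite (cocircuit-∉ μ a∉I′) fx) fν) le)
        where
        fν = proj₁ (⊙-finite⁻ {ν (J′ - a)} fa)
        fx = proj₂ (⊙-finite⁻ {ν (J′ - a)} fa)
        a∉I′ = cocircuit-finite μ fx

      cocircuit⇒incidence : Circuit′ → Incidence
      cocircuit⇒incidence bal a (a∈J′ , a∉I′) fa
        with bal a a∈J′ (⊙-finite (proj₂ (⊙-finite⁻ {μ (I′ ∪ ⁅ a ⁆)} fa))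
               (subst Finite (sym (cocircuit-∉ μ a∉I′)) (proj₁ (⊙-finite⁻ {μ (I′ ∪ ⁅ a ⁆)} fa))))
      ... | b , b≢a , b∈J′ , le = b , b≢a , (b∈J′ , b∉I′) ,
        ⊙-≤T-comm fa′ (subst₂ (λ y z → ν (J′ - b) ⊙ y ≤T ν (J′ - a) ⊙ z) (cocircuit-∉ μ b∉I′) (cocircuit-∉ μ a∉I′) le)
        where
        fa′ : Finite (ν (J′ - a) ⊙ μ (I′ ∪ ⁅ a ⁆))
        fa′ = ⊙-finite (proj₂ (⊙-finite⁻ {μ (I′ ∪ ⁅ a ⁆)} fa)) (proj₁ (⊙-finite⁻ {μ (I′ ∪ ⁅ a ⁆)} fa))
        b∉I′ : b ∉ I′
        b∉I′ = cocircuit-finite μ (proj₂ (⊙-finite⁻ {ν (J′ - b)} (≤T-finite le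
          (subst (λ z → Finite (ν (J′ - a) ⊙ z)) (sym (cocircuit-∉ μ a∉I′)) fa′))))

  -- Equivalence of exchange with the Plücker relations and with the flag of linear spaces.

  module _ {n k : ℕ} (r : Fin k → ℕ) (μ : Fin k → Subset n → 𝕋)
           (valuated : ∀ i → IsValuatedMatroid (μ i) (r i)) where

    private
      nonempty : ∀ i → ∃ (Bases (μ i) (r i))
      nonempty i = proj₁ (proj₁ (valuated i))

    A⇒B : CondA r μ → CondB r μ
    A⇒B (_ , incidence) i j i<j = incidence⇒quotient (incidence i j i<j)

    B⇒A : CondB r μ → CondA r μ
    B⇒A condB = (λ i → quotient⇒grassmann (proj₂ (valuated i))) , λ i j i<j → quotient⇒incidence (condB i j i<j)

    B⇒D : CondB r μ → CondD r μ
    B⇒D condB i j i<j x tropx = orthogonal⇒projTrop (proj₂ (valuated j)) (nonempty j) (proj₁ tropx)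
      (projTrop⇒orthogonal (condB i j i<j) (nonempty i) tropx)

    -- The valuated cocircuits of μ i lie in its projective tropical linear space,
    -- and their orthogonality to the circuits of μ j is the incidence relation.
    D⇒B : CondD r μ → CondB r μ
    D⇒B condD i j i<j = incidence⇒quotient λ I′ J′ ∣I′∣ ∣J′∣ →
      balanced⇒minTwice (List.allFin n) ∈-allFin (λ h → (h ∈? J′) ×-dec ¬? (h ∈? I′))
        (balanced I′ J′ ∣I′∣ ∣J′∣)
      where
      balanced : ∀ I′ J′ → suc ∣ I′ ∣ ≡ r i → ∣ J′ ∣ ≡ suc (r j) →
        Balanced (λ h → h ∈ J′ × h ∉ I′) (λ h → μ i (I′ ∪ ⁅ h ⁆) ⊙ μ j (J′ - h))
      balanced I′ J′ ∣I′∣ ∣J′∣ a (a∈J′ , a∉I′) fa =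
        cocircuit⇒incidence {μ = μ i} {ν = μ j}
          (projTrop⇒orthogonal (proj₂ (valuated j)) (nonempty j) in-trop-j J′ ∣J′∣) a (a∈J′ , a∉I′) fa
        where
        x : Fin n → 𝕋
        x = cocircuit (μ i) I′
        x-proj : IsProjPoint x
        x-proj = a , subst Finite (sym (cocircuit-∉ (μ i) a∉I′)) (proj₁ (⊙-finite⁻ fa))
        in-trop-j : InProjTrop (μ j) (r j) x
        in-trop-j = condD i j i<j x (orthogonal⇒projTrop (proj₂ (valuated i)) (nonempty i) x-proj
          λ K′ ∣K′∣ → incidence⇒cocircuit {μ = μ i} {ν = μ i}
            (quotient⇒balanced (proj₂ (valuated i)) I′ K′ ∣I′∣ ∣K′∣))

theoremA : (ℝ : Reals) → let open Trop ℝ in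
    (n k : ℕ) (r : Fin k → ℕ) (μ : Fin k → Subset n → 𝕋) →
    (∀ i j → i ≤ᶠ j → r i ≤ r j) →
    (∀ i → IsValuatedMatroid (μ i) (r i)) →
    IsFlagMatroid {n} {k} (λ i → Bases (μ i) (r i)) →
    (CondA r μ ⇔ CondB r μ) × (CondB r μ ⇔ CondC r μ) × (CondC r μ ⇔ CondD r μ)
theoremA ℝ n k r μ _ valuated _ =
  mk⇔ (A⇒B r μ valuated) (B⇒A r μ valuated) ,
  mk⇔ (B⇒C r μ valuated) (C⇒B r μ valuated) ,
  mk⇔ (B⇒D r μ valuated ∘ C⇒B r μ valuated) (B⇒C r μ valuated ∘ D⇒B r μ valuated)
  where
  open Tropical ℝ
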